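{- Let $G$ be a topological group, let $\mathfrak M$ be an I-finite $G$-Mackey system and let $\mathcal U$ be a descent basis for $\mathfrak M$. Then the functor $(-)^*_{\mathcal U}:\mathsf{Mack}(\mathfrak M,\mathsf{Ab})\to{}_G\mathsf{Ab}^{\mathrm d}$ is left adjoint to the functor $(-)_*:{}_G\mathsf{Ab}^{\mathrm d}\to\mathsf{Mack}(\mathfrak M,\mathsf{Ab})$.
   Context: ${}_G\mathsf{Ab}^{\mathrm d}$ is the category of discrete $G$-modules. ${}^gH=gHg^{ -1}$, $H^g=g^{ -1}Hg$. A $G$-subgroup system $\mathfrak S=(\mathfrak S_{\mathrm b},\mathfrak S_{\mathrm r},\mathfrak S_{\mathrm i})$ consists of a non-empty set $\mathfrak S_{\mathrm b}$ of subgroups of $G$ closed under conjugation and, for each $H\in\mathfrak S_{\mathrm b}$ and $\star\in\{\mathrm r,\mathrm i\}$, a set $\mathfrak S_\star(H)\subseteq\{I\in\mathfrak S_{\mathrm b}:I\le H\}$ with $H\in\mathfrak S_\star(H)$; $I\in\mathfrak S_\star(H)\Rightarrow\mathfrak S_\star(I)\subseteq\mathfrak S_\star(H)$; ${}^g\mathfrak S_\star(H)=\mathfrak S_\star({}^gH)$. It is I-finite if $[H:I]<\infty$ for $I\in\mathfrak S_{\mathrm i}(H)$. It is a $G$-Mackey system if for $I\in\mathfrak S_{\mathrm r}(H)$, $J\in\mathfrak S_{\mathrm i}(H)$ the set $I\backslash H/J$ is finite, $I\cap J\in\mathfrak S_{\mathrm r}(J)$ and $I\cap J\in\mathfrak S_{\mathrm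 i}(I)$. A Mackey functor $\Phi:\mathfrak M\to\mathsf{Ab}$ consists of abelian groups $\Phi(H)$ ($H\in\mathfrak M_{\mathrm b}$) and homomorphisms $\mathrm{res}_{I,H}:\Phi(H)\to\Phi(I)$ ($I\in\mathfrak M_{\mathrm r}(H)$), $\mathrm{ind}_{H,I}:\Phi(I)\to\Phi(H)$ ($I\in\mathfrak M_{\mathrm i}(H)$), $\mathrm{con}_{g,H}:\Phi(H)\to\Phi({}^gH)$ ($g\in G$) with: $\mathrm{res}_{H,H}=\mathrm{ind}_{H,H}=\mathrm{id}$, $\mathrm{con}_{h,H}=\mathrm{id}$ for $h\in H$; $\mathrm{res}_{J,I}\mathrm{res}_{I,H}=\mathrm{res}_{J,H}$, $\mathrm{ind}_{H,I}\mathrm{ind}_{I,J}=\mathrm{ind}_{H,J}$, $\mathrm{con}_{g',{}^gH}\mathrm{con}_{g,H}=\mathrm{con}_{g'g,H}$; $\mathrm{con}_{g,I}\mathrm{res}_{I,H}=\mathrm{res}_{{}^gI,{}^gH}\mathrm{con}_{g,H}$, $\mathrm{con}_{g,H}\mathrm{ind}_{H,I}=\mathrm{ind}_{{}^gH,{}^gI}\mathrm{con}_{g,I}$; and $\mathrm{res}_{I,H}\mathrm{ind}_{H,J}=\sum_{h}\mathrm{ind}_{I,I\cap{}^hJ}\,\mathrm{con}_{h,I^h\cap J}\,\mathrm{res}_{I^h\cap J,J}$ ($h$ over representatives of $I\backslash H/J$) for $I\in\mathfrak M_{\mathrm r}(H)$, $J\in\mathfrak M_{\mathrm i}(H)$.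 Morphisms are families of homomorphisms commuting with res, ind, con; the category is $\mathsf{Mack}(\mathfrak M,\mathsf{Ab})$. A descent basis for $\mathfrak M$ is a subset $\mathcal U\subseteq\mathfrak M_{\mathrm b}$ of open normal subgroups of $G$ which is a filter basis on $G$ (non-empty, and any two members contain a third in their intersection) such that $\mathcal U(H):=\{U\in\mathcal U:U\le H\}\subseteq\mathfrak M_{\mathrm r}(H)$ and $\mathcal U(H)\ne\emptyset$ for each $H\in\mathfrak M_{\mathrm b}$. The functor $(-)_*$: $A_*(H)=A^H$, res = inclusion $A^H\to A^I$, $\mathrm{ind}_{H,I}(a)=\sum_{h\in H/I}ha$, $\mathrm{con}_{g,H}(a)=ga$; on morphisms by restriction. The functor $(-)^*_{\mathcal U}$: $\Phi^*_{\mathcal U}=\mathrm{colim}_{U\in(\mathcal U,\supseteq)}\Phi(U)$ along the restrictions $\mathrm{res}_{V,U}$ ($U\supseteq V$), with $g\in G$ acting on the class of $a\in\Phi(U)$ as the class of $\mathrm{con}_{g,U}(a)\in\Phi(U)$ (a discrete $G$-module); on morphisms induced by the $\varphi_U$. -}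

module Defs where

open import Algebra.Bundles using (Group; AbelianGroup)
open import Algebra.Morphism.Bundles using (GroupHomomorphism)
import Algebra.Morphism.Construct.Composition as Composition
import Algebra.Morphism.Construct.Identity as Identity
import Algebra.Properties.AbelianGroup as AbelianGroupProperties
import Algebra.Properties.CommutativeMonoid.Sum as Sum
import Algebra.Properties.Group as GroupProperties
open import Data.Fin.Base using (Fin; zero; suc; _↑ˡ_; _↑ʳ_; splitAt; join)
open import Data.Fin.Permutation using (Permutation; permutation; _⟨$⟩ʳ_)
open import Data.Fin.Properties using (splitAt-↑ˡ; splitAt-↑ʳ; join-splitAt)
open import Data.Nat.Base as ℕ using (ℕ)
open import Data.Product.Base using (Σ; ∃; ∃-syntax; ∃₂; Σ-syntax; _×_; _,_; proj₁; proj₂)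
open import Data.Sum.Base using (_⊎_; inj₁; inj₂)
open import Data.Unit.Polymorphic.Base using (⊤)
open import Function.Base using (_∘_; id)
open import Function.Bundles using (Inverse; _⇔_; Equivalence)
open import Level using (Level; _⊔_) renaming (suc to lsuc)
open import Relation.Binary.Bundles using (Setoid)
open import Relation.Binary.Core using (Rel)
open import Relation.Binary.Definitions using (Symmetric; Transitive; _Respects_)
open import Relation.Binary.PropositionalEquality.Core as ≡ using (_≡_)
open import Relation.Binary.Structures using (IsEquivalence)
import Relation.Binary.Reasoning.Setoid as ≈-Reasoning
open import Relation.Unary using (Pred; _∈_; _⊆_; _≐_; _∩_; ⋃)

record Category (o h e : Level) : Set (lsuc (o ⊔ h ⊔ e)) where
  infix  4 _≈_
  infixr 9 _∘′_
  field
    Obj       : Set o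
    _⇒_       : Obj → Obj → Set h
    _≈_       : ∀ {X Y} → Rel (X ⇒ Y) e
    id′       : ∀ {X} → X ⇒ X
    _∘′_      : ∀ {X Y Z} → Y ⇒ Z → X ⇒ Y → X ⇒ Z
    equiv     : ∀ {X Y} → IsEquivalence (_≈_ {X} {Y})
    assoc     : ∀ {W X Y Z} (f : Y ⇒ Z) (g : X ⇒ Y) (k : W ⇒ X) →
                (f ∘′ g) ∘′ k ≈ f ∘′ (g ∘′ k)
    identityˡ : ∀ {X Y} (f : X ⇒ Y) → id′ ∘′ f ≈ f
    identityʳ : ∀ {X Y} (f : X ⇒ Y) → f ∘′ id′ ≈ f
    ∘-cong    : ∀ {X Y Z} {f f′ : Y ⇒ Z} {g g′ : X ⇒ Y} →
                f ≈ f′ → g ≈ g′ → f ∘′ g ≈ f′ ∘′ g′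

  homSetoid : Obj → Obj → Setoid h e
  homSetoid X Y = record { Carrier = X ⇒ Y ; _≈_ = _≈_ ; isEquivalence = equiv }

record Functor {o h e o′ h′ e′} (C : Category o h e) (D : Category o′ h′ e′) :
               Set (o ⊔ h ⊔ e ⊔ o′ ⊔ h′ ⊔ e′) where
  private
    module C = Category C
    module D = Category D
  field
    F₀   : C.Obj → D.Obj
    F₁   : ∀ {X Y} → X C.⇒ Y → F₀ X D.⇒ F₀ Y
    F-≈  : ∀ {X Y} {f g : X C.⇒ Y} → f C.≈ g → F₁ f D.≈ F₁ g
    F-id : ∀ {X} → F₁ (C.id′ {X}) D.≈ D.id′
    F-∘  : ∀ {X Y Z} (f : Y C.⇒ Z) (g : X C.⇒ Y) →
           F₁ (f C.∘′ g) D.≈ F₁ f D.∘′ F₁ g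

infix 4 _⊣_

record _⊣_ {o h e o′ h′ e′} {C : Category o h e} {D : Category o′ h′ e′}
           (L : Functor C D) (R : Functor D C) : Set (o ⊔ h ⊔ e ⊔ o′ ⊔ h′ ⊔ e′) where
  private
    module C = Category C
    module D = Category D
    module L = Functor L
    module R = Functor R
  field
    hom↔    : ∀ X Y → Inverse (D.homSetoid (L.F₀ X) Y) (C.homSetoid X (R.F₀ Y))
    natural : ∀ {X X′ Y Y′} (f : X′ C.⇒ X) (g : Y D.⇒ Y′) (k : L.F₀ X D.⇒ Y) →
              Inverse.to (hom↔ X′ Y′) (g D.∘′ (k D.∘′ L.F₁ f))
                C.≈ R.F₁ g C.∘′ (Inverse.to (hom↔ X Y) k C.∘′ f)

∣_∣ : ∀ {c e} → AbelianGroup c e → Set c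
∣ A ∣ = AbelianGroup.Carrier A

Hom : ∀ {c e c′ e′} → AbelianGroup c e → AbelianGroup c′ e′ → Set (c ⊔ e ⊔ c′ ⊔ e′)
Hom A B = GroupHomomorphism (AbelianGroup.rawGroup A) (AbelianGroup.rawGroup B)

open GroupHomomorphism using (⟦_⟧; ⟦⟧-cong; homo; ε-homo; ⁻¹-homo)

idHom : ∀ {c e} (A : AbelianGroup c e) → Hom A A
idHom A = record
  { isGroupHomomorphism = Identity.isGroupHomomorphism _ (AbelianGroup.refl A) }

_∘ʰ_ : ∀ {c e} {A B C : AbelianGroup c e} → Hom B C → Hom A B → Hom A C
_∘ʰ_ {C = C} f g = record
  { isGroupHomomorphism = Composition.isGroupHomomorphism (AbelianGroup.trans C)
      (GroupHomomorphism.isGroupHomomorphism g) (GroupHomomorphism.isGroupHomomorphism f) }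

mkHom : ∀ {c e c′ e′} (A : AbelianGroup c e) (B : AbelianGroup c′ e′)
        (f : ∣ A ∣ → ∣ B ∣) →
        (∀ {x y} → AbelianGroup._≈_ A x y → AbelianGroup._≈_ B (f x) (f y)) →
        (∀ x y → AbelianGroup._≈_ B (f (AbelianGroup._∙_ A x y))
                                    (AbelianGroup._∙_ B (f x) (f y))) →
        Hom A B
mkHom A B f f-cong f-homo = record
  { ⟦_⟧ = f
  ; isGroupHomomorphism = record
    { isMonoidHomomorphism = record
      { isMagmaHomomorphism = record
        { isRelHomomorphism = record { cong = f-cong } ; homo = f-homo }
      ; ε-homo = ε-h
      }
    ; ⁻¹-homo = λ x → inverseˡ-unique (f (x A.⁻¹)) (f x)
        (B.trans (B.sym (f-homo _ _)) (B.trans (f-cong (A.inverseˡ x)) ε-h))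
    }
  }
  where
  module A = AbelianGroup A
  module B = AbelianGroup B
  open AbelianGroupProperties B using (identityˡ-unique; inverseˡ-unique)
  ε-h : f A.ε B.≈ B.ε
  ε-h = identityˡ-unique (f A.ε) (f A.ε)
    (B.trans (B.sym (f-homo _ _)) (f-cong (A.identityˡ A.ε)))

∑ : ∀ {c e} (A : AbelianGroup c e) {n : ℕ} → (Fin n → ∣ A ∣) → ∣ A ∣
∑ A = Sum.sum (AbelianGroup.commutativeMonoid A)

module _ {c e} (A : AbelianGroup c e) where
  open AbelianGroup A

  ∑-cong : ∀ {n} {f g : Fin n → Carrier} → (∀ k → f k ≈ g k) → ∑ A f ≈ ∑ A g
  ∑-cong = Sum.sum-cong-≋ commutativeMonoid

  ∑-+ : ∀ m {n} (f : Fin (m ℕ.+ n) → Carrier) →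
        ∑ A f ≈ ∑ A (λ k → f (k ↑ˡ n)) ∙ ∑ A (λ k → f (m ↑ʳ k))
  ∑-+ ℕ.zero    f = sym (identityˡ _)
  ∑-+ (ℕ.suc m) f = trans (∙-congˡ (∑-+ m (f ∘ suc))) (sym (assoc _ _ _))

hom-∑ : ∀ {c e c′ e′} (A : AbelianGroup c e) (B : AbelianGroup c′ e′) (φ : Hom A B)
        {n} (f : Fin n → ∣ A ∣) →
        AbelianGroup._≈_ B (⟦ φ ⟧ (∑ A f)) (∑ B (λ k → ⟦ φ ⟧ (f k)))
hom-∑ A B φ {ℕ.zero}  f = ε-homo φ
hom-∑ A B φ {ℕ.suc n} f =
  AbelianGroup.trans B (homo φ _ _) (AbelianGroup.∙-congˡ B (hom-∑ A B φ (f ∘ suc)))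

total : ∀ {n} → (Fin n → ℕ) → ℕ
total {ℕ.zero}  m = 0
total {ℕ.suc n} m = m zero ℕ.+ total (m ∘ suc)

split : ∀ {n} (m : Fin n → ℕ) → Fin (total m) → Σ (Fin n) (Fin ∘ m)
split⁺ : ∀ {n} (m : Fin (ℕ.suc n) → ℕ) →
         Fin (m zero) ⊎ Fin (total (m ∘ suc)) → Σ (Fin (ℕ.suc n)) (Fin ∘ m)
split {ℕ.suc n} m j = split⁺ m (splitAt (m zero) j)
split⁺ m (inj₁ l) = zero , l
split⁺ m (inj₂ j) = suc (proj₁ (split (m ∘ suc) j)) , proj₂ (split (m ∘ suc) j)

merge : ∀ {n} (m : Fin n → ℕ) (k : Fin n) → Fin (m k) → Fin (total m)
merge m zero    l = l ↑ˡ _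
merge m (suc k) l = m zero ↑ʳ merge (m ∘ suc) k l

split-merge : ∀ {n} (m : Fin n → ℕ) k l → split m (merge m k l) ≡ (k , l)
split-merge m zero    l = ≡.cong (split⁺ m) (splitAt-↑ˡ (m zero) l _)
split-merge m (suc k) l = ≡.trans
  (≡.cong (split⁺ m) (splitAt-↑ʳ (m zero) _ (merge (m ∘ suc) k l)))
  (≡.cong (λ (k , l) → suc k , l) (split-merge (m ∘ suc) k l))

merge-split : ∀ {n} (m : Fin n → ℕ) j →
              merge m (proj₁ (split m j)) (proj₂ (split m j)) ≡ j
merge-split {ℕ.suc n} m j =
  ≡.trans (merge-split⁺ (splitAt (m zero) j)) (join-splitAt (m zero) _ j)
  where
  merge-split⁺ : ∀ s → merge m (proj₁ (split⁺ m s)) (proj₂ (split⁺ m s))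
                       ≡ join (m zero) (total (m ∘ suc)) s
  merge-split⁺ (inj₁ l) = ≡.refl
  merge-split⁺ (inj₂ j) = ≡.cong (m zero ↑ʳ_) (merge-split (m ∘ suc) j)

split-injective : ∀ {n} (m : Fin n → ℕ) {i j} → split m i ≡ split m j → i ≡ j
split-injective m {i} {j} eq = ≡.trans (≡.sym (merge-split m i))
  (≡.trans (≡.cong (λ (k , l) → merge m k l) eq) (merge-split m j))

∑-merge : ∀ {c e} (A : AbelianGroup c e) {n} (m : Fin n → ℕ) (f : Fin (total m) → ∣ A ∣) →
          AbelianGroup._≈_ A (∑ A f) (∑ A (λ k → ∑ A (λ l → f (merge m k l))))
∑-merge A {ℕ.zero}  m f = AbelianGroup.refl A
∑-merge A {ℕ.suc n} m f = AbelianGroup.trans A (∑-+ A (m zero) f)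
  (AbelianGroup.∙-congˡ A (∑-merge A (m ∘ suc) (λ j → f (m zero ↑ʳ j))))

-- A bijection between some Fin n and the set of ∼-classes meeting H.  Its
-- existence also serves as the definition of that set of classes being finite.
record Representatives {c h e} {X : Set c} (H : Pred X h) (_∼_ : Rel X e) :
                       Set (c ⊔ h ⊔ e) where
  field
    size     : ℕ
    rep      : Fin size → X
    rep∈     : ∀ k → rep k ∈ H
    covers   : ∀ {x} → x ∈ H → ∃[ k ] x ∼ rep k
    distinct : ∀ {k l} → rep k ∼ rep l → k ≡ l

open Representatives public

module _ {x h r c e} {X : Set x} {H : Pred X h} {_∼_ : Rel X r}
         (∼-sym : Symmetric _∼_) (∼-trans : Transitive _∼_)
         (A : AbelianGroup c e) (f : X → ∣ A ∣)
         (f-cong : ∀ {x y} → x ∼ y → AbelianGroup._≈_ A (f x) (f y))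
         where

  ∑-reps : (R S : Representatives H _∼_) →
           AbelianGroup._≈_ A (∑ A (f ∘ rep R)) (∑ A (f ∘ rep S))
  ∑-reps R S = AbelianGroup.trans A
    (Sum.sum-permute (AbelianGroup.commutativeMonoid A) (f ∘ rep R) π)
    (∑-cong A (λ k → f-cong (∼-sym (proj₂ (covers R (rep∈ S k))))))
    where
    to : ∀ (R S : Representatives H _∼_) → Fin (size R) → Fin (size S)
    to R S k = proj₁ (covers S (rep∈ R k))
    to-to : ∀ R S k → to R S (to S R k) ≡ k
    to-to R S k = ≡.sym (distinct S
      (∼-trans (proj₂ (covers R (rep∈ S k))) (proj₂ (covers S (rep∈ R _)))))
    π : Permutation (size S) (size R)
    π = permutation (to S R) (to R S) (to-to S R) (to-to R S)

  ∑∑-reps : (R : Representatives H _∼_) {n : ℕ} (m : Fin n → ℕ)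
            (y : ∀ k → Fin (m k) → X) →
            (∀ k l → y k l ∈ H) →
            (∀ {x} → x ∈ H → ∃₂ λ k l → x ∼ y k l) →
            (∀ {k l k′ l′} → y k l ∼ y k′ l′ → _≡_ {A = Σ (Fin n) (Fin ∘ m)} (k , l) (k′ , l′)) →
            AbelianGroup._≈_ A (∑ A (f ∘ rep R)) (∑ A (λ k → ∑ A (λ l → f (y k l))))
  ∑∑-reps R m y y∈ y-covers y-distinct = AbelianGroup.trans A (∑-reps R S)
    (AbelianGroup.trans A (∑-merge A m (f ∘ rep S))
      (∑-cong A (λ k → ∑-cong A (λ l → AbelianGroup.reflexive A
        (≡.cong (λ (k , l) → f (y k l)) (split-merge m k l))))))
    where
    S : Representatives H _∼_
    S = record
      { size     = total m
      ; rep      = λ j → y (proj₁ (split m j)) (proj₂ (split m j))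
      ; rep∈     = λ j → y∈ _ _
      ; covers   = λ {x} x∈ → let k , l , q = y-covers x∈ in merge m k l ,
          ≡.subst (λ (k , l) → x ∼ y k l) (≡.sym (split-merge m k l)) q
      ; distinct = λ q → split-injective m (y-distinct q)
      }

record Topology {ℓ} (S : Setoid ℓ ℓ) (t : Level) : Set (lsuc (ℓ ⊔ t)) where
  open Setoid S
  field
    Open        : Pred (Pred Carrier ℓ) t
    open-resp-≈ : ∀ {U} → Open U → U Respects _≈_
    open-resp-≐ : ∀ {U V} → U ≐ V → Open U → Open V
    open-full   : Open (λ _ → ⊤)
    open-∩      : ∀ {U V} → Open U → Open V → Open (U ∩ V)
    -- Families in Set ℓ suffice: a U that is a neighbourhood of each of its
    -- points is the union of a family indexed by ∃ U : Set ℓ.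
    open-⋃      : ∀ {I : Set ℓ} (U : I → Pred Carrier ℓ) →
                  (∀ i → Open (U i)) → Open (⋃ I U)

record TopologicalGroup (ℓ t : Level) : Set (lsuc (ℓ ⊔ t)) where
  field
    group    : Group ℓ ℓ
    topology : Topology (Group.setoid group) t
  open Group group public
  open Topology topology public
  field
    ∙-continuous  : ∀ {W} → Open W → ∀ {g h} → g ∙ h ∈ W →
                    ∃₂ λ U V → Open U × Open V × g ∈ U × h ∈ V ×
                    (∀ {x y} → x ∈ U → y ∈ V → x ∙ y ∈ W)
    ⁻¹-continuous : ∀ {W} → Open W → Open (λ x → x ⁻¹ ∈ W)

record Subgroup {ℓ} (G : Group ℓ ℓ) : Set (lsuc ℓ) where
  open Group G
  field
    mem  : Pred Carrier ℓ
    resp : mem Respects _≈_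
    ε∈   : ε ∈ mem
    ∙∈   : ∀ {x y} → x ∈ mem → y ∈ mem → x ∙ y ∈ mem
    ⁻¹∈  : ∀ {x} → x ∈ mem → x ⁻¹ ∈ mem

open Subgroup

module Conjugation {ℓ} (G : Group ℓ ℓ) where
  open Group G
  open GroupProperties G
  open ≈-Reasoning setoid

  c : Carrier → Carrier → Carrier
  c g x = g ⁻¹ ∙ x ∙ g

  c-cong : ∀ {g g′ x x′} → g ≈ g′ → x ≈ x′ → c g x ≈ c g′ x′
  c-cong p q = ∙-cong (∙-cong (⁻¹-cong p) q) p

  g∙c : ∀ g x → g ∙ c g x ≈ x ∙ g
  g∙c g x = begin
    g ∙ (g ⁻¹ ∙ x ∙ g)   ≈⟨ ∙-congˡ (assoc _ _ _) ⟩
    g ∙ (g ⁻¹ ∙ (x ∙ g)) ≈⟨ \\-leftDividesˡ g (x ∙ g) ⟩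
    x ∙ g                ∎

  c-unique : ∀ {g x y} → g ∙ y ≈ x ∙ g → y ≈ c g x
  c-unique {g} {x} {y} p = ∙-cancelˡ g _ _ (trans p (sym (g∙c g x)))

  c-∙ : ∀ g x y → c g (x ∙ y) ≈ c g x ∙ c g y
  c-∙ g x y = sym (c-unique (begin
    g ∙ (c g x ∙ c g y) ≈⟨ assoc _ _ _ ⟨
    g ∙ c g x ∙ c g y   ≈⟨ ∙-congʳ (g∙c g x) ⟩
    x ∙ g ∙ c g y       ≈⟨ assoc _ _ _ ⟩
    x ∙ (g ∙ c g y)     ≈⟨ ∙-congˡ (g∙c g y) ⟩
    x ∙ (y ∙ g)         ≈⟨ assoc _ _ _ ⟨
    x ∙ y ∙ g           ∎))

  c-ε : ∀ g → c g ε ≈ ε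
  c-ε g = sym (c-unique (trans (identityʳ g) (sym (identityˡ g))))

  c-⁻¹ : ∀ g x → c g (x ⁻¹) ≈ c g x ⁻¹
  c-⁻¹ g x = inverseˡ-unique _ _ (begin
    c g (x ⁻¹) ∙ c g x ≈⟨ c-∙ g (x ⁻¹) x ⟨
    c g (x ⁻¹ ∙ x)     ≈⟨ c-cong refl (inverseˡ x) ⟩
    c g ε              ≈⟨ c-ε g ⟩
    ε                  ∎)

  c-id : ∀ x → c ε x ≈ x
  c-id x = sym (c-unique (trans (identityˡ x) (sym (identityʳ x))))

  c-c : ∀ g h x → c g (c h x) ≈ c (h ∙ g) x
  c-c g h x = c-unique (begin
    h ∙ g ∙ c g (c h x)   ≈⟨ assoc _ _ _ ⟩
    h ∙ (g ∙ c g (c h x)) ≈⟨ ∙-congˡ (g∙c g (c h x)) ⟩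
    h ∙ (c h x ∙ g)       ≈⟨ assoc _ _ _ ⟨
    h ∙ c h x ∙ g         ≈⟨ ∙-congʳ (g∙c h x) ⟩
    x ∙ h ∙ g             ≈⟨ assoc _ _ _ ⟩
    x ∙ (h ∙ g)           ∎)

  c⁻¹-c : ∀ g x → c (g ⁻¹) (c g x) ≈ x
  c⁻¹-c g x = trans (c-c _ _ x) (trans (c-cong (inverseʳ g) refl) (c-id x))

  c-c⁻¹ : ∀ g x → c g (c (g ⁻¹) x) ≈ x
  c-c⁻¹ g x = trans (c-c _ _ x) (trans (c-cong (inverseˡ g) refl) (c-id x))

module _ {ℓ} {G : Group ℓ ℓ} where
  open Group G
  open Conjugation G

  infixr 8 _▷_
  infixl 8 _◁_
  infixr 7 _∩ₛ_

  -- ᵍH = gHg⁻¹, using x ∈ gHg⁻¹ ⇔ g⁻¹xg ∈ H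
  _▷_ : Carrier → Subgroup G → Subgroup G
  g ▷ H = record
    { mem  = λ x → g ⁻¹ ∙ x ∙ g ∈ mem H
    ; resp = λ p → resp H (c-cong refl p)
    ; ε∈   = resp H (sym (c-ε g)) (ε∈ H)
    ; ∙∈   = λ p q → resp H (sym (c-∙ g _ _)) (∙∈ H p q)
    ; ⁻¹∈  = λ p → resp H (sym (c-⁻¹ g _)) (⁻¹∈ H p)
    }

  -- Hᵍ = g⁻¹Hg
  _◁_ : Subgroup G → Carrier → Subgroup G
  H ◁ g = (g ⁻¹) ▷ H

  _∩ₛ_ : Subgroup G → Subgroup G → Subgroup G
  I ∩ₛ J = record
    { mem  = mem I ∩ mem J
    ; resp = λ p (q , r) → resp I p q , resp J p r
    ; ε∈   = ε∈ I , ε∈ J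
    ; ∙∈   = λ (p , q) (p′ , q′) → ∙∈ I p p′ , ∙∈ J q q′
    ; ⁻¹∈  = λ (p , q) → ⁻¹∈ I p , ⁻¹∈ J q
    }

  Normal : Pred (Subgroup G) ℓ
  Normal H = ∀ g {x} → x ∈ mem H → g ∙ x ∙ g ⁻¹ ∈ mem H

  LeftCoset : Subgroup G → Rel Carrier ℓ
  LeftCoset J x y = ∃[ j ] j ∈ mem J × x ≈ y ∙ j

  DoubleCoset : Subgroup G → Subgroup G → Rel Carrier ℓ
  DoubleCoset I J x y = ∃₂ λ i j → i ∈ mem I × j ∈ mem J × x ≈ i ∙ y ∙ j

  _/_ : Subgroup G → Subgroup G → Set ℓ
  H / J = Representatives (mem H) (LeftCoset J)

  [_╲_/_] : Subgroup G → Subgroup G → Subgroup G → Set ℓ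
  [ I ╲ H / J ] = Representatives (mem H) (DoubleCoset I J)

  ▷-self : ∀ (H : Subgroup G) {h} → h ∈ mem H → mem H ≐ mem (h ▷ H)
  ▷-self H {h} h∈ =
    (λ p → ∙∈ H (∙∈ H (⁻¹∈ H h∈) p) h∈) ,
    (λ {x} p → resp H (c⁻¹-c h x)
                 (∙∈ H (∙∈ H (⁻¹∈ H (⁻¹∈ H h∈)) p) (⁻¹∈ H h∈)))

  ▷-normal : ∀ {H : Subgroup G} → Normal H → ∀ g → mem H ≐ mem (g ▷ H)
  ▷-normal {H} n g =
    (λ {x} p → resp H (∙-congˡ (⁻¹-involutive g)) (n (g ⁻¹) p)) ,
    (λ {x} p → resp H (trans (∙-congʳ (∙-congʳ (sym (⁻¹-involutive g)))) (c⁻¹-c g x)) (n g p))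
    where open GroupProperties G using (⁻¹-involutive)

  ∩▷-◁∩ : ∀ (I J : Subgroup G) h → mem (I ∩ₛ h ▷ J) ≐ mem (h ▷ (I ◁ h ∩ₛ J))
  ∩▷-◁∩ I J h =
    (λ {x} (p , q) → resp I (sym (c⁻¹-c h x)) p , q) ,
    (λ {x} (p , q) → resp I (c⁻¹-c h x) p , q)

  module _ (J : Subgroup G) where
    LeftCoset-sym : Symmetric (LeftCoset J)
    LeftCoset-sym (j , j∈ , p) =
      j ⁻¹ , ⁻¹∈ J j∈ , trans (x≈z//y _ _ _ refl) (∙-congʳ (sym p))
      where open GroupProperties G using (x≈z//y)

    LeftCoset-trans : Transitive (LeftCoset J)
    LeftCoset-trans (j , j∈ , p) (k , k∈ , q) =
      k ∙ j , ∙∈ J k∈ j∈ , trans p (trans (∙-congʳ q) (assoc _ _ _))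

data Star : Set where
  𝐫 𝐢 : Star

record SubgroupSystem {ℓ} (G : Group ℓ ℓ) (s : Level) : Set (lsuc (ℓ ⊔ s)) where
  open Group G using (Carrier)
  field
    𝔖ᵇ          : Pred (Subgroup G) s
    𝔖ᵇ-resp     : ∀ {H H′} → mem H ≐ mem H′ → H ∈ 𝔖ᵇ → H′ ∈ 𝔖ᵇ
    𝔖ᵇ-nonempty : ∃[ H ] H ∈ 𝔖ᵇ
    𝔖ᵇ-conj     : ∀ g {H} → H ∈ 𝔖ᵇ → g ▷ H ∈ 𝔖ᵇ

  Base : Set (lsuc ℓ ⊔ s)
  Base = ∃[ H ] H ∈ 𝔖ᵇ

  ⌊_⌋ : Base → Pred Carrier ℓ
  ⌊ H ⌋ = mem (proj₁ H)

  infixr 8 _▷ᵇ_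
  _▷ᵇ_ : Carrier → Base → Base
  g ▷ᵇ (H , H∈) = g ▷ H , 𝔖ᵇ-conj g H∈

  field
    𝔖       : Star → Base → Pred Base s
    𝔖-resp  : ∀ ⋆ {H H′ I I′} → ⌊ H ⌋ ≐ ⌊ H′ ⌋ → ⌊ I ⌋ ≐ ⌊ I′ ⌋ → I ∈ 𝔖 ⋆ H → I′ ∈ 𝔖 ⋆ H′
    𝔖-≤     : ∀ ⋆ {H I} → I ∈ 𝔖 ⋆ H → ⌊ I ⌋ ⊆ ⌊ H ⌋
    𝔖-refl  : ∀ ⋆ {H} → H ∈ 𝔖 ⋆ H
    𝔖-trans : ∀ ⋆ {H I} → I ∈ 𝔖 ⋆ H → 𝔖 ⋆ I ⊆ 𝔖 ⋆ H
    𝔖-conj  : ∀ ⋆ g {H K} →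
              (∃[ I ] I ∈ 𝔖 ⋆ H × ⌊ K ⌋ ≐ ⌊ g ▷ᵇ I ⌋) ⇔ K ∈ 𝔖 ⋆ (g ▷ᵇ H)

  IFinite : Set (lsuc ℓ ⊔ s)
  IFinite = ∀ {H I} → I ∈ 𝔖 𝐢 H → proj₁ H / proj₁ I

record MackeySystem {ℓ} (G : Group ℓ ℓ) (s : Level) : Set (lsuc (ℓ ⊔ s)) where
  open Group G using (Carrier; _⁻¹)
  field
    system : SubgroupSystem G s
  open SubgroupSystem system public
  field
    ╲╱-finite : ∀ {H I J} → I ∈ 𝔖 𝐫 H → J ∈ 𝔖 𝐢 H → [ proj₁ I ╲ proj₁ H / proj₁ J ]
    ∩∈𝔖ᵇ      : ∀ {H I J} → I ∈ 𝔖 𝐫 H → J ∈ 𝔖 𝐢 H → proj₁ I ∩ₛ proj₁ J ∈ 𝔖ᵇ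
    ∩∈𝔖𝐫      : ∀ {H I J} (p : I ∈ 𝔖 𝐫 H) (q : J ∈ 𝔖 𝐢 H) →
                (proj₁ I ∩ₛ proj₁ J , ∩∈𝔖ᵇ p q) ∈ 𝔖 𝐫 J
    ∩∈𝔖𝐢      : ∀ {H I J} (p : I ∈ 𝔖 𝐫 H) (q : J ∈ 𝔖 𝐢 H) →
                (proj₁ I ∩ₛ proj₁ J , ∩∈𝔖ᵇ p q) ∈ 𝔖 𝐢 I

  ▷∈𝔖 : ∀ ⋆ {H I h} → h ∈ ⌊ H ⌋ → I ∈ 𝔖 ⋆ H → h ▷ᵇ I ∈ 𝔖 ⋆ H
  ▷∈𝔖 ⋆ {H} {I} {h} h∈ p = 𝔖-resp ⋆ {h ▷ᵇ H} {H} {h ▷ᵇ I} {h ▷ᵇ I} (≐-swap (▷-self (proj₁ H) h∈)) (id , id)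
    (Equivalence.to (𝔖-conj ⋆ h) (I , p , id , id))
    where
    ≐-swap : ∀ {P Q : Pred Carrier ℓ} → P ≐ Q → Q ≐ P
    ≐-swap (p , q) = q , p

  module _ {H I J : Base} (p : I ∈ 𝔖 𝐫 H) (q : J ∈ 𝔖 𝐢 H) {h : Carrier} (h∈ : h ∈ ⌊ H ⌋) where

    I∩ʰJ : Base
    I∩ʰJ = proj₁ I ∩ₛ h ▷ proj₁ J , ∩∈𝔖ᵇ p (▷∈𝔖 𝐢 h∈ q)

    I∩ʰJ∈𝔖𝐢 : I∩ʰJ ∈ 𝔖 𝐢 I
    I∩ʰJ∈𝔖𝐢 = ∩∈𝔖𝐢 p (▷∈𝔖 𝐢 h∈ q)

    Iʰ∩J : Base
    Iʰ∩J = proj₁ I ◁ h ∩ₛ proj₁ J , ∩∈𝔖ᵇ (▷∈𝔖 𝐫 (⁻¹∈ (proj₁ H) h∈) p) q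

    Iʰ∩J∈𝔖𝐫 : Iʰ∩J ∈ 𝔖 𝐫 J
    Iʰ∩J∈𝔖𝐫 = ∩∈𝔖𝐫 (▷∈𝔖 𝐫 (⁻¹∈ (proj₁ H) h∈) p) q

    I∩ʰJ≐ʰ[Iʰ∩J] : ⌊ I∩ʰJ ⌋ ≐ ⌊ h ▷ᵇ Iʰ∩J ⌋
    I∩ʰJ≐ʰ[Iʰ∩J] = ∩▷-◁∩ (proj₁ I) (proj₁ J) h

module _ {ℓ s} {G : Group ℓ ℓ} (𝔐 : MackeySystem G s) (m : Level) where
  private module G = Group G
  open MackeySystem 𝔐

  -- Subgroups are equal when they are ≐, which does not identify the types
  -- Φ H and Φ H′ for H ≐ H′.  Hence con g takes values in Φ K for every K ≐ ᵍH,
  -- and con ε : Φ H → Φ H′ for H′ ≐ H plays the role of the equality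
  -- Φ H = Φ H′.  All axioms hold for arbitrary membership proofs, so res, ind
  -- and con do not depend on these proofs.
  record MackeyFunctor : Set (lsuc (ℓ ⊔ s ⊔ m)) where
    field
      Φ : Base → AbelianGroup m m

    infix 4 _≈_
    _≈_ : ∀ {H} → Rel ∣ Φ H ∣ m
    _≈_ {H} = AbelianGroup._≈_ (Φ H)

    field
      res : ∀ {H I} → I ∈ 𝔖 𝐫 H → Hom (Φ H) (Φ I)
      ind : ∀ {H I} → I ∈ 𝔖 𝐢 H → Hom (Φ I) (Φ H)
      con : ∀ g {H K} → ⌊ K ⌋ ≐ ⌊ g ▷ᵇ H ⌋ → Hom (Φ H) (Φ K)

      con-cong  : ∀ {g g′ H K} (p : ⌊ K ⌋ ≐ ⌊ g ▷ᵇ H ⌋) (p′ : ⌊ K ⌋ ≐ ⌊ g′ ▷ᵇ H ⌋) →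
                  g G.≈ g′ → ∀ x → ⟦ con g {H} {K} p ⟧ x ≈ ⟦ con g′ {H} {K} p′ ⟧ x

      res-id    : ∀ {H} (p : H ∈ 𝔖 𝐫 H) x → ⟦ res p ⟧ x ≈ x
      ind-id    : ∀ {H} (p : H ∈ 𝔖 𝐢 H) x → ⟦ ind p ⟧ x ≈ x
      con-id    : ∀ {h H} → h ∈ ⌊ H ⌋ → (p : ⌊ H ⌋ ≐ ⌊ h ▷ᵇ H ⌋) →
                  ∀ x → ⟦ con h {H} {H} p ⟧ x ≈ x

      res-trans : ∀ {H I J} (p : I ∈ 𝔖 𝐫 H) (q : J ∈ 𝔖 𝐫 I) (r : J ∈ 𝔖 𝐫 H) →
                  ∀ x → ⟦ res q ⟧ (⟦ res p ⟧ x) ≈ ⟦ res r ⟧ x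
      ind-trans : ∀ {H I J} (p : I ∈ 𝔖 𝐢 H) (q : J ∈ 𝔖 𝐢 I) (r : J ∈ 𝔖 𝐢 H) →
                  ∀ x → ⟦ ind p ⟧ (⟦ ind q ⟧ x) ≈ ⟦ ind r ⟧ x
      con-trans : ∀ {g g′ H K L} (p : ⌊ K ⌋ ≐ ⌊ g ▷ᵇ H ⌋) (q : ⌊ L ⌋ ≐ ⌊ g′ ▷ᵇ K ⌋)
                  (r : ⌊ L ⌋ ≐ ⌊ (g′ G.∙ g) ▷ᵇ H ⌋) →
                  ∀ x → ⟦ con g′ {K} {L} q ⟧ (⟦ con g {H} {K} p ⟧ x)
                        ≈ ⟦ con (g′ G.∙ g) {H} {L} r ⟧ x

      con-res   : ∀ {g H I K L} (p : I ∈ 𝔖 𝐫 H) (q : L ∈ 𝔖 𝐫 K)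
                  (k : ⌊ K ⌋ ≐ ⌊ g ▷ᵇ H ⌋) (l : ⌊ L ⌋ ≐ ⌊ g ▷ᵇ I ⌋) →
                  ∀ x → ⟦ con g {I} {L} l ⟧ (⟦ res p ⟧ x)
                        ≈ ⟦ res q ⟧ (⟦ con g {H} {K} k ⟧ x)
      con-ind   : ∀ {g H I K L} (p : I ∈ 𝔖 𝐢 H) (q : L ∈ 𝔖 𝐢 K)
                  (k : ⌊ K ⌋ ≐ ⌊ g ▷ᵇ H ⌋) (l : ⌊ L ⌋ ≐ ⌊ g ▷ᵇ I ⌋) →
                  ∀ x → ⟦ con g {H} {K} k ⟧ (⟦ ind p ⟧ x)
                        ≈ ⟦ ind q ⟧ (⟦ con g {I} {L} l ⟧ x)

      mackey    : ∀ {H I J} (p : I ∈ 𝔖 𝐫 H) (q : J ∈ 𝔖 𝐢 H)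
                  (R : [ proj₁ I ╲ proj₁ H / proj₁ J ]) (x : ∣ Φ J ∣) →
                  ⟦ res p ⟧ (⟦ ind q ⟧ x) ≈
                  ∑ (Φ I) λ k →
                    ⟦ ind (I∩ʰJ∈𝔖𝐢 p q (rep∈ R k)) ⟧
                    (⟦ con (rep R k) {Iʰ∩J p q (rep∈ R k)} {I∩ʰJ p q (rep∈ R k)}
                           (I∩ʰJ≐ʰ[Iʰ∩J] p q (rep∈ R k)) ⟧
                    (⟦ res (Iʰ∩J∈𝔖𝐫 p q (rep∈ R k)) ⟧ x))

  record MackeyMorphism (Φ Ψ : MackeyFunctor) : Set (lsuc ℓ ⊔ s ⊔ m) where
    private
      module Φ = MackeyFunctor Φ
      module Ψ = MackeyFunctor Ψ
    field
      φ     : ∀ H → Hom (Φ.Φ H) (Ψ.Φ H)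
      φ-res : ∀ {H I} (p : I ∈ 𝔖 𝐫 H) x →
              ⟦ φ I ⟧ (⟦ Φ.res p ⟧ x) Ψ.≈ ⟦ Ψ.res p ⟧ (⟦ φ H ⟧ x)
      φ-ind : ∀ {H I} (p : I ∈ 𝔖 𝐢 H) x →
              ⟦ φ H ⟧ (⟦ Φ.ind p ⟧ x) Ψ.≈ ⟦ Ψ.ind p ⟧ (⟦ φ I ⟧ x)
      φ-con : ∀ g {H K} (p : ⌊ K ⌋ ≐ ⌊ g ▷ᵇ H ⌋) x →
              ⟦ φ K ⟧ (⟦ Φ.con g {H} {K} p ⟧ x) Ψ.≈ ⟦ Ψ.con g {H} {K} p ⟧ (⟦ φ H ⟧ x)

  Mack : Category (lsuc (ℓ ⊔ s ⊔ m)) (lsuc ℓ ⊔ s ⊔ m) (lsuc ℓ ⊔ s ⊔ m)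
  Mack = record
    { Obj = MackeyFunctor
    ; _⇒_ = MackeyMorphism
    ; _≈_ = λ {_} {Ψ} α β → ∀ H x → MackeyFunctor._≈_ Ψ (⟦ φ α H ⟧ x) (⟦ φ β H ⟧ x)
    ; id′ = λ {Φ} → record
      { φ     = λ H → idHom (MackeyFunctor.Φ Φ H)
      ; φ-res = λ {_} {I} p x → AbelianGroup.refl (MackeyFunctor.Φ Φ I)
      ; φ-ind = λ {H} p x → AbelianGroup.refl (MackeyFunctor.Φ Φ H)
      ; φ-con = λ g {_} {K} p x → AbelianGroup.refl (MackeyFunctor.Φ Φ K)
      }
    ; _∘′_ = λ {Φ} {Ψ} {Ξ} α β → let module Ξ H = AbelianGroup (MackeyFunctor.Φ Ξ H) in record
      { φ     = λ H → _∘ʰ_ {A = MackeyFunctor.Φ Φ H} {MackeyFunctor.Φ Ψ H}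
                           {MackeyFunctor.Φ Ξ H} (φ α H) (φ β H)
      ; φ-res = λ {H} {I} p x → Ξ.trans I (⟦⟧-cong (φ α I) (φ-res β p x)) (φ-res α p _)
      ; φ-ind = λ {H} {I} p x → Ξ.trans H (⟦⟧-cong (φ α H) (φ-ind β p x)) (φ-ind α p _)
      ; φ-con = λ g {H} {K} p x → Ξ.trans K (⟦⟧-cong (φ α K) (φ-con β g p x)) (φ-con α g p _)
      }
    ; equiv = λ {_} {Ψ} → let module Ψ H = AbelianGroup (MackeyFunctor.Φ Ψ H) in record
      { refl  = λ H x → Ψ.refl H
      ; sym   = λ p H x → Ψ.sym H (p H x)
      ; trans = λ p q H x → Ψ.trans H (p H x) (q H x)
      }
    ; assoc     = λ {_} {_} {_} {Z} f g k H x → AbelianGroup.refl (MackeyFunctor.Φ Z H)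
    ; identityˡ = λ {_} {Y} f H x → AbelianGroup.refl (MackeyFunctor.Φ Y H)
    ; identityʳ = λ {_} {Y} f H x → AbelianGroup.refl (MackeyFunctor.Φ Y H)
    ; ∘-cong    = λ {_} {_} {Z} {f} {f′} {g} {g′} p q H x →
        AbelianGroup.trans (MackeyFunctor.Φ Z H) (⟦⟧-cong (φ f H) (q H x)) (p H _)
    }
    where open MackeyMorphism

module _ {ℓ t} (𝔾 : TopologicalGroup ℓ t) (m : Level) where
  private module G = TopologicalGroup 𝔾

  record DiscreteModule : Set (lsuc (ℓ ⊔ m) ⊔ t) where
    infixr 8 _·_
    field
      abelianGroup : AbelianGroup m m
    open AbelianGroup abelianGroup public
      renaming (_∙_ to _+_; ε to 0#; _⁻¹ to -_; ∙-cong to +-cong)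
    field
      _·_         : G.Carrier → Carrier → Carrier
      ·-cong      : ∀ {g g′ a a′} → g G.≈ g′ → a ≈ a′ → g · a ≈ g′ · a′
      ·-distrib-+ : ∀ g a b → g · (a + b) ≈ g · a + g · b
      ·-assoc     : ∀ g g′ a → (g G.∙ g′) · a ≈ g · (g′ · a)
      ·-identity  : ∀ a → G.ε · a ≈ a
      -- continuity of G × A → A at (g , a), where A is discrete
      ·-continuous : ∀ g a → ∃[ V ] G.Open V × g ∈ V × (∀ {v} → v ∈ V → v · a ≈ g · a)

    ·-hom : G.Carrier → Hom abelianGroup abelianGroup
    ·-hom g = mkHom abelianGroup abelianGroup (g ·_) (·-cong G.refl) (·-distrib-+ g)

  record ModuleMorphism (A B : DiscreteModule) : Set (ℓ ⊔ m) where
    private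
      module A = DiscreteModule A
      module B = DiscreteModule B
    field
      hom         : Hom A.abelianGroup B.abelianGroup
      equivariant : ∀ g a → ⟦ hom ⟧ (g A.· a) B.≈ g B.· ⟦ hom ⟧ a

  DiscreteModules : Category (lsuc (ℓ ⊔ m) ⊔ t) (ℓ ⊔ m) m
  DiscreteModules = record
    { Obj  = DiscreteModule
    ; _⇒_  = ModuleMorphism
    ; _≈_  = λ {A} {B} α β → ∀ a → DiscreteModule._≈_ B (⟦ hom α ⟧ a) (⟦ hom β ⟧ a)
    ; id′  = λ {A} → record
      { hom = idHom (DiscreteModule.abelianGroup A)
      ; equivariant = λ g a → DiscreteModule.refl A }
    ; _∘′_ = λ {A} {B} {C} α β → record
      { hom = _∘ʰ_ {A = DiscreteModule.abelianGroup A} {DiscreteModule.abelianGroup B}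
                   {DiscreteModule.abelianGroup C} (hom α) (hom β)
      ; equivariant = λ g a → DiscreteModule.trans C
          (⟦⟧-cong (hom α) (equivariant β g a)) (equivariant α g _) }
    ; equiv = λ {_} {B} → record
      { refl  = λ a → DiscreteModule.refl B
      ; sym   = λ p a → DiscreteModule.sym B (p a)
      ; trans = λ p q a → DiscreteModule.trans B (p a) (q a)
      }
    ; assoc     = λ {_} {_} {_} {Z} f g k x → DiscreteModule.refl Z
    ; identityˡ = λ {_} {Y} f x → DiscreteModule.refl Y
    ; identityʳ = λ {_} {Y} f x → DiscreteModule.refl Y
    ; ∘-cong    = λ {_} {_} {Z} {f} {f′} {g} {g′} p q x →
        DiscreteModule.trans Z (⟦⟧-cong (hom f) (q x)) (p _)
    }
    where open ModuleMorphism

module _ {ℓ t} (m : Level) {𝔾 : TopologicalGroup ℓ t} (A : DiscreteModule 𝔾 (ℓ ⊔ m)) where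
  private
    module G = TopologicalGroup 𝔾
    open module A = DiscreteModule A
    open Conjugation G.group

  Fixed : Subgroup G.group → Pred Carrier (ℓ ⊔ m)
  Fixed H a = ∀ {h} → h ∈ mem H → h · a ≈ a

  infix 9 _^_
  _^_ : Subgroup G.group → AbelianGroup (ℓ ⊔ m) (ℓ ⊔ m)
  _^_ H = record
    { Carrier = ∃[ a ] a ∈ Fixed H
    ; _≈_ = λ (a , _) (b , _) → a ≈ b
    ; _∙_ = λ (a , p) (b , q) →
        a + b , λ h∈ → trans (·-distrib-+ _ a b) (+-cong (p h∈) (q h∈))
    ; ε   = 0# , λ _ → ε-homo (·-hom _)
    ; _⁻¹ = λ (a , p) → (- a) , λ h∈ → trans (⁻¹-homo (·-hom _) a) (⁻¹-cong (p h∈))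
    ; isAbelianGroup = record
      { isGroup = record
        { isMonoid = record
          { isSemigroup = record
            { isMagma = record
              { isEquivalence = record { refl = refl ; sym = sym ; trans = trans }
              ; ∙-cong = +-cong }
            ; assoc = λ _ _ _ → assoc _ _ _ }
          ; identity = (λ _ → identityˡ _) , (λ _ → identityʳ _) }
        ; inverse = (λ _ → inverseˡ _) , (λ _ → inverseʳ _)
        ; ⁻¹-cong = ⁻¹-cong }
      ; comm = λ _ _ → comm _ _ }
    }

  ^-inclusion : ∀ H → Hom (_^_ H) abelianGroup
  ^-inclusion H = mkHom (_^_ H) abelianGroup proj₁ id (λ _ _ → refl)

  ^-res : ∀ {H I} → mem I ⊆ mem H → Hom (_^_ H) (_^_ I)
  ^-res {H} {I} I≤H = mkHom (_^_ H) (_^_ I)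
    (λ (a , p) → a , λ h∈ → p (I≤H h∈)) id (λ _ _ → refl)

  ^-con : ∀ g {H K} → mem K ≐ mem (g ▷ H) → Hom (_^_ H) (_^_ K)
  ^-con g {H} {K} K≐ = mkHom (_^_ H) (_^_ K)
    (λ (a , p) → g · a , λ {k} k∈ → begin
      k · g · a           ≈⟨ ·-assoc k g a ⟨
      (k G.∙ g) · a       ≈⟨ ·-cong (g∙c g k) refl ⟨
      (g G.∙ c g k) · a   ≈⟨ ·-assoc g (c g k) a ⟩
      g · c g k · a       ≈⟨ ·-cong G.refl (p (proj₁ K≐ k∈)) ⟩
      g · a               ∎)
    (·-cong G.refl) (λ _ _ → ·-distrib-+ g _ _)
    where open ≈-Reasoning setoid

  private
    module S = Sum commutativeMonoid

  orbit-cong : ∀ {I a} → a ∈ Fixed I → ∀ {x y} → LeftCoset I x y → x · a ≈ y · a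
  orbit-cong {a = a} p {x} {y} (j , j∈ , x≈yj) =
    trans (·-cong x≈yj refl) (trans (·-assoc y j a) (·-cong G.refl (p j∈)))

  ·-∑ : ∀ g {n} (f : Fin n → Carrier) → g · ∑ abelianGroup f ≈ ∑ abelianGroup (λ k → g · f k)
  ·-∑ g = hom-∑ abelianGroup abelianGroup (·-hom g)

  translate : ∀ {H I : Subgroup G.group} {h} → h ∈ mem H → H / I → H / I
  translate {H} {I} {h} h∈ R = record
    { size     = size R
    ; rep      = λ k → h G.∙ rep R k
    ; rep∈     = λ k → ∙∈ H h∈ (rep∈ R k)
    ; covers   = λ {x} x∈ →
        let k , j , j∈ , p = covers R (∙∈ H (⁻¹∈ H h∈) x∈) in
        k , j , j∈ , G.trans (G.sym (\\-leftDividesˡ h x))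
                       (G.trans (G.∙-congˡ p) (G.sym (G.assoc _ _ _)))
    ; distinct = λ (j , j∈ , p) →
        distinct R (j , j∈ , ∙-cancelˡ h _ _ (G.trans p (G.assoc _ _ _)))
    }
    where open GroupProperties G.group using (\\-leftDividesˡ; ∙-cancelˡ)

  conjugate : ∀ {g} {H I K L : Subgroup G.group} → mem K ≐ mem (g ▷ H) → mem L ≐ mem (g ▷ I) →
              K / L → H / I
  conjugate {g} {H} {I} {K} {L} K≐ L≐ R = record
    { size     = size R
    ; rep      = λ k → c g (rep R k)
    ; rep∈     = λ k → proj₁ K≐ (rep∈ R k)
    ; covers   = λ {x} x∈ →
        let k , j , j∈ , p = covers R (proj₂ K≐ (resp H (G.sym (c-c⁻¹ g x)) x∈)) in
        k , c g j , proj₁ L≐ j∈ ,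
        G.trans (G.sym (c-c⁻¹ g x)) (G.trans (c-cong G.refl p) (c-∙ g _ _))
    ; distinct = λ {k} {l} (j , j∈ , p) →
        distinct R (c (g G.⁻¹) j , proj₂ L≐ (resp I (G.sym (c-c⁻¹ g j)) j∈) ,
          G.trans (G.sym (c⁻¹-c g (rep R k)))
            (G.trans (c-cong G.refl p)
              (G.trans (c-∙ (g G.⁻¹) _ _) (G.∙-congʳ (c⁻¹-c g (rep R l))))))
    }

  -- Independent of R by ∑-reps.
  ^-ind : ∀ {H I} → H / I → Hom (_^_ I) (_^_ H)
  ^-ind {H} {I} R = mkHom (_^_ I) (_^_ H)
    (λ (a , p) → ∑ abelianGroup (λ k → rep R k · a) , λ {h} h∈ → begin
      h · ∑ abelianGroup (λ k → rep R k · a)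
        ≈⟨ ·-∑ h (λ k → rep R k · a) ⟩
      ∑ abelianGroup (λ k → h · rep R k · a)
        ≈⟨ ∑-cong abelianGroup {size R} (λ k → ·-assoc h (rep R k) a) ⟨
      ∑ abelianGroup (λ k → (h G.∙ rep R k) · a)
        ≈⟨ ∑-reps (LeftCoset-sym I) (LeftCoset-trans I) abelianGroup (_· a) (orbit-cong {I} p)
             (translate {H} {I} h∈ R) R ⟩
      ∑ abelianGroup (λ k → rep R k · a) ∎)
    (λ a≈b → ∑-cong abelianGroup {size R} (λ k → ·-cong G.refl a≈b))
    (λ (a , _) (b , _) → trans
      (∑-cong abelianGroup {size R} (λ k → ·-distrib-+ (rep R k) a b))
      (S.∑-distrib-+ {size R} (λ k → rep R k · a) (λ k → rep R k · b)))
    where open ≈-Reasoning setoid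

  module _ {s} {𝔐 : MackeySystem G.group s} (finite : MackeySystem.IFinite 𝔐) where
    private
      open MackeySystem 𝔐

    ^-ind-id : ∀ (H : Subgroup G.group) (R : H / H) x → proj₁ (⟦ ^-ind {H} {H} R ⟧ x) ≈ proj₁ x
    ^-ind-id H R (a , p) = trans
      (∑-reps (LeftCoset-sym H) (LeftCoset-trans H) abelianGroup (_· a) (orbit-cong {H} p) R S)
      (trans (identityʳ _) (·-identity a))
      where
      S : H / H
      S = record
        { size     = 1
        ; rep      = λ _ → G.ε
        ; rep∈     = λ _ → ε∈ H
        ; covers   = λ {x} x∈ → zero , x , x∈ , G.sym (G.identityˡ x)
        ; distinct = λ { {zero} {zero} _ → ≡.refl }
        }

    ^-ind-trans : ∀ (H I J : Subgroup G.group) → mem I ⊆ mem H → mem J ⊆ mem I →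
                  (P : H / I) (Q : I / J) (R : H / J) → ∀ x →
                  proj₁ (⟦ ^-ind {H} {I} P ⟧ (⟦ ^-ind {I} {J} Q ⟧ x))
                    ≈ proj₁ (⟦ ^-ind {H} {J} R ⟧ x)
    ^-ind-trans H I J I≤H J≤I P Q R (a , p) = sym (begin
      ∑ abelianGroup (λ k → rep R k · a)
        ≈⟨ ∑∑-reps (LeftCoset-sym J) (LeftCoset-trans J) abelianGroup (_· a) (orbit-cong {J} p)
             R (λ _ → size Q) (λ k l → rep P k G.∙ rep Q l)
             (λ k l → ∙∈ H (rep∈ P k) (I≤H (rep∈ Q l)))
             (λ x∈ → let k , i , i∈ , e = covers P x∈
                         l , j , j∈ , f = covers Q i∈ in
               k , l , j , j∈ ,
               G.trans e (G.trans (G.∙-congˡ f) (G.sym (G.assoc _ _ _))))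
             PQ-distinct ⟩
      ∑ abelianGroup (λ k → ∑ abelianGroup (λ l → (rep P k G.∙ rep Q l) · a))
        ≈⟨ ∑-cong abelianGroup {size P} (λ k → trans (·-∑ (rep P k) (λ l → rep Q l · a))
             (∑-cong abelianGroup {size Q} (λ l → sym (·-assoc (rep P k) (rep Q l) a)))) ⟨
      ∑ abelianGroup (λ k → rep P k · ∑ abelianGroup (λ l → rep Q l · a)) ∎)
      where
      open ≈-Reasoning setoid
      open GroupProperties G.group using (∙-cancelˡ; x≈z//y)
      PQ-distinct : ∀ {k l k′ l′} → LeftCoset J (rep P k G.∙ rep Q l) (rep P k′ G.∙ rep Q l′) →
                    _≡_ {A = Fin (size P) × Fin (size Q)} (k , l) (k′ , l′)
      PQ-distinct {k} {l} {k′} {l′} (j , j∈ , e) = lemma k≡k′ e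
        where
        k≡k′ : k ≡ k′
        k≡k′ = distinct P
          ( (rep Q l′ G.∙ j) G.// rep Q l
          , ∙∈ I (∙∈ I (rep∈ Q l′) J∋j) (⁻¹∈ I (rep∈ Q l))
          , G.trans (x≈z//y _ _ _ e)
              (G.trans (G.∙-congʳ (G.assoc _ _ _)) (G.assoc _ _ _)))
          where
          J∋j : j ∈ mem I
          J∋j = J≤I j∈
        lemma : ∀ {k} → k ≡ k′ → rep P k G.∙ rep Q l G.≈ rep P k′ G.∙ rep Q l′ G.∙ j →
                _≡_ {A = Fin (size P) × Fin (size Q)} (k , l) (k′ , l′)
        lemma ≡.refl e = ≡.cong (k′ ,_)
          (distinct Q (j , j∈ , ∙-cancelˡ _ _ _ (G.trans e (G.assoc _ _ _))))

    ^-con-ind : ∀ (H I K L : Subgroup G.group) {g} → (P : H / I) (Q : K / L) →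
                (k : mem K ≐ mem (g ▷ H)) (l : mem L ≐ mem (g ▷ I)) → ∀ x →
                proj₁ (⟦ ^-con g {H} {K} k ⟧ (⟦ ^-ind {H} {I} P ⟧ x))
                  ≈ proj₁ (⟦ ^-ind {K} {L} Q ⟧ (⟦ ^-con g {I} {L} l ⟧ x))
    ^-con-ind H I K L {g} P Q k l (a , p) = begin
      g · ∑ abelianGroup (λ k → rep P k · a)
        ≈⟨ ·-cong G.refl (∑-reps (LeftCoset-sym I) (LeftCoset-trans I) abelianGroup (_· a)
             (orbit-cong {I} p) P (conjugate {g} {H} {I} {K} {L} k l Q)) ⟩
      g · ∑ abelianGroup (λ k → c g (rep Q k) · a)
        ≈⟨ ·-∑ g (λ k → c g (rep Q k) · a) ⟩
      ∑ abelianGroup (λ k → g · c g (rep Q k) · a)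
        ≈⟨ ∑-cong abelianGroup {size Q} (λ k → trans (sym (·-assoc g _ a))
             (trans (·-cong (g∙c g (rep Q k)) refl) (·-assoc (rep Q k) g a))) ⟩
      ∑ abelianGroup (λ k → rep Q k · g · a) ∎
      where open ≈-Reasoning setoid

    ^-mackey : ∀ {H I J} (p : I ∈ 𝔖 𝐫 H) (q : J ∈ 𝔖 𝐢 H)
               (R : [ proj₁ I ╲ proj₁ H / proj₁ J ]) (P : proj₁ H / proj₁ J)
               (Q : ∀ k → proj₁ I / proj₁ (I∩ʰJ p q (rep∈ R k))) →
               ∀ {a} → a ∈ Fixed (proj₁ J) →
               ∑ abelianGroup (λ k → rep P k · a) ≈
               ∑ abelianGroup (λ k → ∑ abelianGroup (λ l → rep (Q k) l · rep R k · a))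
    ^-mackey {H , _} {I , _} {J , _} p q R P Q {a} a∈ = trans
      (∑∑-reps (LeftCoset-sym J) (LeftCoset-trans J) abelianGroup (_· a) (orbit-cong {J} a∈)
        P (λ k → size (Q k)) y
        (λ k l → ∙∈ H (𝔖-≤ 𝐫 p (rep∈ (Q k) l)) (rep∈ R k))
        y-covers y-distinct)
      (∑-cong abelianGroup {size R} (λ k → ∑-cong abelianGroup {size (Q k)} (λ l →
        ·-assoc (rep (Q k) l) (rep R k) a)))
      where
      open ≈-Reasoning G.setoid
      open GroupProperties G.group using (\\-leftDividesˡ; y≈x\\z)
      y : ∀ k → Fin (size (Q k)) → G.Carrier
      y k l = rep (Q k) l G.∙ rep R k

      y-covers : ∀ {x} → x ∈ mem H → ∃₂ λ k l → LeftCoset J x (y k l)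
      y-covers {x} x∈ =
        let k , i , j , i∈ , j∈ , e = covers R x∈
            l , u , (_ , u∈) , f = covers (Q k) i∈
            h = rep R k
            s = rep (Q k) l
        in k , l , c h u G.∙ j , ∙∈ J u∈ j∈ , (begin
          x                           ≈⟨ e ⟩
          i G.∙ h G.∙ j               ≈⟨ G.∙-congʳ (G.∙-congʳ f) ⟩
          s G.∙ u G.∙ h G.∙ j         ≈⟨ G.∙-congʳ (G.assoc _ _ _) ⟩
          s G.∙ (u G.∙ h) G.∙ j       ≈⟨ G.∙-congʳ (G.∙-congˡ (g∙c h u)) ⟨
          s G.∙ (h G.∙ c h u) G.∙ j   ≈⟨ G.∙-congʳ (G.assoc _ _ _) ⟨
          s G.∙ h G.∙ c h u G.∙ j     ≈⟨ G.assoc _ _ _ ⟩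
          s G.∙ h G.∙ (c h u G.∙ j)   ∎)

      y-distinct : ∀ {k l k′ l′} → LeftCoset J (y k l) (y k′ l′) →
                   _≡_ {A = Σ (Fin (size R)) (λ k → Fin (size (Q k)))} (k , l) (k′ , l′)
      y-distinct {k} {l} {k′} {l′} (j , j∈ , e) = lemma (distinct R
          ( s₁ G.\\ s′ , j , ∙∈ I (⁻¹∈ I (rep∈ (Q k) l)) (rep∈ (Q k′) l′) , j∈ , (begin
            rep R k                       ≈⟨ y≈x\\z s₁ (rep R k) _ e ⟩
            s₁ G.\\ (s′ G.∙ rep R k′ G.∙ j) ≈⟨ G.assoc _ _ _ ⟨
            s₁ G.⁻¹ G.∙ (s′ G.∙ rep R k′) G.∙ j ≈⟨ G.∙-congʳ (G.assoc _ _ _) ⟨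
            (s₁ G.\\ s′) G.∙ rep R k′ G.∙ j  ∎))) l e
        where
        s₁ = rep (Q k) l
        s′ = rep (Q k′) l′
        lemma : ∀ {k} → k ≡ k′ → (l : Fin (size (Q k))) → y k l G.≈ y k′ l′ G.∙ j →
                _≡_ {A = Σ (Fin (size R)) (λ k → Fin (size (Q k)))} (k , l) (k′ , l′)
        lemma ≡.refl l e = ≡.cong (k′ ,_) (distinct (Q k′)
          ( u
          , ( ∙∈ I (⁻¹∈ I (rep∈ (Q k′) l′)) (rep∈ (Q k′) l)
            , resp J (c-unique (begin
                h G.∙ j                        ≈⟨ \\-leftDividesʳ s′ _ ⟨
                s′ G.\\ (s′ G.∙ (h G.∙ j))     ≈⟨ G.∙-congˡ (G.assoc _ _ _) ⟨
                s′ G.\\ (s′ G.∙ h G.∙ j)       ≈⟨ G.∙-congˡ e ⟨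
                s′ G.\\ (rep (Q k′) l G.∙ h)   ≈⟨ G.assoc _ _ _ ⟨
                u G.∙ h                        ∎)) j∈ )
          , G.sym (\\-leftDividesˡ s′ (rep (Q k′) l)) ))
          where
          open GroupProperties G.group using (\\-leftDividesʳ)
          h = rep R k′
          u = s′ G.\\ rep (Q k′) l

    fixedPoints : MackeyFunctor 𝔐 (ℓ ⊔ m)
    fixedPoints = record
      { Φ         = λ H → _^_ (proj₁ H)
      ; res       = λ {H} {I} p → ^-res {proj₁ H} {proj₁ I} (𝔖-≤ 𝐫 p)
      ; ind       = λ {H} {I} p → ^-ind {proj₁ H} {proj₁ I} (finite p)
      ; con       = λ g {H} {K} p → ^-con g {proj₁ H} {proj₁ K} p
      ; con-cong  = λ _ _ g≈g′ _ → ·-cong g≈g′ refl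
      ; res-id    = λ _ _ → refl
      ; ind-id    = λ {H} p x → ^-ind-id (proj₁ H) (finite p) x
      ; con-id    = λ h∈ _ (_ , p) → p h∈
      ; res-trans = λ _ _ _ _ → refl
      ; ind-trans = λ {H} {I} {J} p q r x → ^-ind-trans (proj₁ H) (proj₁ I) (proj₁ J)
                      (𝔖-≤ 𝐢 p) (𝔖-≤ 𝐢 q) (finite p) (finite q) (finite r) x
      ; con-trans = λ {g} {g′} _ _ _ (a , _) → sym (·-assoc g′ g a)
      ; con-res   = λ _ _ _ _ _ → refl
      ; con-ind   = λ {g} {H} {I} {K} {L} p q k l x →
                      ^-con-ind (proj₁ H) (proj₁ I) (proj₁ K) (proj₁ L) (finite p) (finite q) k l x
      ; mackey    = λ {H} {I} {J} p q R (a , a∈) → trans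
                      (^-mackey p q R (finite q) (λ k → finite (I∩ʰJ∈𝔖𝐢 p q (rep∈ R k))) a∈)
                      (sym (hom-∑ (_^_ (proj₁ I)) abelianGroup (^-inclusion (proj₁ I)) {size R} _))
      }

module _ {ℓ t s} {𝔾 : TopologicalGroup ℓ t}
         {𝔐 : MackeySystem (TopologicalGroup.group 𝔾) s} (finite : MackeySystem.IFinite 𝔐)
         (m : Level) where
  open ModuleMorphism

  fixedPointsFunctor : Functor (DiscreteModules 𝔾 (ℓ ⊔ m)) (Mack 𝔐 (ℓ ⊔ m))
  fixedPointsFunctor = record
    { F₀   = λ A → fixedPoints m A finite
    ; F₁   = λ {A} {B} f →
        let module B = DiscreteModule B
            A^ = _^_ m A ; B^ = _^_ m B
            ∣A∣ = DiscreteModule.abelianGroup A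
        in record
        { φ     = λ (H , _) → mkHom (A^ H) (B^ H)
            (λ (a , p) → ⟦ hom f ⟧ a , λ h∈ →
              B.trans (B.sym (equivariant f _ a)) (⟦⟧-cong (hom f) (p h∈)))
            (⟦⟧-cong (hom f)) (λ _ _ → homo (hom f) _ _)
        ; φ-res = λ _ _ → B.refl
        ; φ-ind = λ p (a , _) → B.trans
            (hom-∑ ∣A∣ B.abelianGroup (hom f) {size (finite p)} _)
            (∑-cong B.abelianGroup {size (finite p)} (λ k → equivariant f (rep (finite p) k) a))
        ; φ-con = λ g _ (a , _) → equivariant f g a
        }
    ; F-≈  = λ f≈g _ (a , _) → f≈g a
    ; F-id = λ {A} _ _ → DiscreteModule.refl A
    ; F-∘  = λ {_} {_} {C} _ _ _ _ → DiscreteModule.refl C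
    }

record DescentBasis {ℓ t s} (𝔾 : TopologicalGroup ℓ t)
                    (𝔐 : MackeySystem (TopologicalGroup.group 𝔾) s) : Set (lsuc (ℓ ⊔ s) ⊔ t) where
  open TopologicalGroup 𝔾 using (group; Open)
  open MackeySystem 𝔐 using (𝔖ᵇ; 𝔖; Base; ⌊_⌋)
  field
    𝒰          : Pred (Subgroup group) s
    𝒰-resp     : ∀ {U V} → mem U ≐ mem V → U ∈ 𝒰 → V ∈ 𝒰
    𝒰⊆𝔖ᵇ       : 𝒰 ⊆ 𝔖ᵇ
    𝒰-open     : ∀ {U} → U ∈ 𝒰 → Open (mem U)
    𝒰-normal   : 𝒰 ⊆ Normal
    𝒰-nonempty : ∃[ U ] U ∈ 𝒰
    𝒰-filter   : ∀ {U V} → U ∈ 𝒰 → V ∈ 𝒰 → ∃[ W ] W ∈ 𝒰 × mem W ⊆ mem U ∩ mem V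
    𝒰-res      : ∀ (H : Base) {U} (U∈ : U ∈ 𝒰) → mem U ⊆ ⌊ H ⌋ → (U , 𝒰⊆𝔖ᵇ U∈) ∈ 𝔖 𝐫 H
    𝒰-below    : ∀ (H : Base) → ∃[ U ] U ∈ 𝒰 × mem U ⊆ ⌊ H ⌋

module _ {ℓ t s} (a : Level) {𝔾 : TopologicalGroup ℓ t}
         {𝔐 : MackeySystem (TopologicalGroup.group 𝔾) s} (𝔘 : DescentBasis 𝔾 𝔐) where
  private
    module G = TopologicalGroup 𝔾
    -- 𝒰 is a predicate on Subgroup : Set (lsuc ℓ), so the colimit over it lives here
    L = lsuc ℓ ⊔ s ⊔ a
  open MackeySystem 𝔐
  open DescentBasis 𝔘

  Index : Set (lsuc ℓ ⊔ s)
  Index = ∃[ U ] U ∈ 𝒰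

  base : Index → Base
  base (U , U∈) = U , 𝒰⊆𝔖ᵇ U∈

  infix 4 _⊑_
  _⊑_ : Rel Index ℓ
  W ⊑ U = mem (proj₁ W) ⊆ mem (proj₁ U)

  lower : (U V : Index) → ∃[ W ] W ⊑ U × W ⊑ V
  lower (U , U∈) (V , V∈) =
    let W , W∈ , p = 𝒰-filter U∈ V∈
    in (W , W∈) , (λ x∈ → proj₁ (p x∈)) , (λ x∈ → proj₂ (p x∈))

  ▷-≐ : ∀ g (U : Index) → ⌊ base U ⌋ ≐ ⌊ g ▷ᵇ base U ⌋
  ▷-≐ g (U , U∈) = ▷-normal {H = U} (𝒰-normal U∈) g

  module _ (Φ : MackeyFunctor 𝔐 L) where
    private
      module Φ = MackeyFunctor Φ
      module Ab U = AbelianGroup (Φ.Φ (base U))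

    -- colim Φ(U) is the setoid of pairs (U , x ∈ Φ(U)); as 𝒰 is a filter basis,
    -- two pairs have the same class iff they agree after restriction to some W.
    Germ : Set L
    Germ = ∃[ U ] ∣ Φ.Φ (base U) ∣

    _↾_ : (x : Germ) {W : Index} → W ⊑ proj₁ x → ∣ Φ.Φ (base W) ∣
    _↾_ (U , x) {W} W⊑U = ⟦ Φ.res (𝒰-res (base U) (proj₂ W) W⊑U) ⟧ x

    infix 4 _∼_
    _∼_ : Rel Germ L
    x ∼ y = ∃[ W ] Σ[ p ∈ W ⊑ proj₁ x ] Σ[ q ∈ W ⊑ proj₁ y ]
            (_↾_ x {W} p Φ.≈ _↾_ y {W} q)

    res-irrelevant : ∀ {H I} (p q : I ∈ 𝔖 𝐫 H) x → ⟦ Φ.res p ⟧ x Φ.≈ ⟦ Φ.res q ⟧ x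
    res-irrelevant {H} {I} p q x = I.trans (I.sym (Φ.res-id (𝔖-refl 𝐫) _))
      (Φ.res-trans p (𝔖-refl 𝐫) q x)
      where module I = AbelianGroup (Φ.Φ I)

    ↾-↾ : ∀ x {V W} (p : W ⊑ proj₁ x) (q : V ⊑ W) (r : V ⊑ proj₁ x) →
          _↾_ (W , _↾_ x {W} p) {V} q Φ.≈ _↾_ x {V} r
    ↾-↾ x p q r = Φ.res-trans _ _ _ _

    ↾-cong : ∀ {x y} ((W , _) : x ∼ y) {V} → V ⊑ W →
             (p : V ⊑ proj₁ x) (q : V ⊑ proj₁ y) → _↾_ x {V} p Φ.≈ _↾_ y {V} q
    ↾-cong {x} {y} (W , p′ , q′ , e) {V} r p q = Ab.trans V
      (Ab.sym V (↾-↾ x {V} {W} p′ r p))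
      (Ab.trans V (⟦⟧-cong (Φ.res _) e) (↾-↾ y {V} {W} q′ r q))

    pointwise : ∀ {U x y} → x Φ.≈ y → (U , x) ∼ (U , y)
    pointwise {U} e = U , id , id , ⟦⟧-cong (Φ.res _) e

    _⊕_ : Germ → Germ → Germ
    x ⊕ y = let W , p , q = lower (proj₁ x) (proj₁ y)
            in W , Ab._∙_ W (_↾_ x {W} p) (_↾_ y {W} q)

    ⊖_ : Germ → Germ
    ⊖ (U , x) = U , Ab._⁻¹ U x

    𝟘 : Germ
    𝟘 = 𝒰-nonempty , Ab.ε 𝒰-nonempty

    ⊕-⊑ˡ : ∀ x y → proj₁ (x ⊕ y) ⊑ proj₁ x
    ⊕-⊑ˡ x y = proj₁ (proj₂ (lower (proj₁ x) (proj₁ y)))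

    ⊕-⊑ʳ : ∀ x y → proj₁ (x ⊕ y) ⊑ proj₁ y
    ⊕-⊑ʳ x y = proj₂ (proj₂ (lower (proj₁ x) (proj₁ y)))

    ↾-⊕ : ∀ x y {W} (p : W ⊑ proj₁ (x ⊕ y)) (q : W ⊑ proj₁ x) (r : W ⊑ proj₁ y) →
          _↾_ (x ⊕ y) {W} p Φ.≈ Ab._∙_ W (_↾_ x {W} q) (_↾_ y {W} r)
    ↾-⊕ x y {W} p q r = Ab.trans W (homo (Φ.res _) _ _)
      (Ab.∙-cong W (↾-↾ x {W} {V} (⊕-⊑ˡ x y) p q) (↾-↾ y {W} {V} (⊕-⊑ʳ x y) p r))
      where V = proj₁ (x ⊕ y)

    ∼-refl : ∀ {x} → x ∼ x
    ∼-refl {U , x} = pointwise {U} (Ab.refl U)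

    ∼-sym : ∀ {x y} → x ∼ y → y ∼ x
    ∼-sym (W , p , q , e) = W , q , p , Ab.sym W e

    ∼-trans : ∀ {x y z} → x ∼ y → y ∼ z → x ∼ z
    ∼-trans {x} {y} {z} α@(V , p , q , _) β@(V′ , p′ , q′ , _) =
      let W , r , r′ = lower V V′ in
      W , (λ w → p (r w)) , (λ w → q′ (r′ w)) ,
      Ab.trans W (↾-cong {x} {y} α {W} r _ (λ w → q (r w)))
                 (↾-cong {y} {z} β {W} r′ _ _)

    ⊕-cong : ∀ {x x′ y y′} → x ∼ x′ → y ∼ y′ → (x ⊕ y) ∼ (x′ ⊕ y′)
    ⊕-cong {x} {x′} {y} {y′} α@(V , _) β@(V′ , _) =
      let W₁ , v , v′ = lower V V′
          W₂ , u , u′ = lower (proj₁ (x ⊕ y)) (proj₁ (x′ ⊕ y′))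
          W , w₁ , w₂ = lower W₁ W₂
      in W , (λ w → u (w₂ w)) , (λ w → u′ (w₂ w)) ,
         Ab.trans W (↾-⊕ x y {W} _ (λ w → ⊕-⊑ˡ x y (u (w₂ w))) (λ w → ⊕-⊑ʳ x y (u (w₂ w))))
         (Ab.trans W
           (Ab.∙-cong W (↾-cong {x} {x′} α {W} (λ w → v (w₁ w)) _ (λ w → ⊕-⊑ˡ x′ y′ (u′ (w₂ w))))
                        (↾-cong {y} {y′} β {W} (λ w → v′ (w₁ w)) _ (λ w → ⊕-⊑ʳ x′ y′ (u′ (w₂ w)))))
           (Ab.sym W (↾-⊕ x′ y′ {W} _ _ _)))

    ⊕-assoc : ∀ x y z → ((x ⊕ y) ⊕ z) ∼ (x ⊕ (y ⊕ z))
    ⊕-assoc x y z =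
      let W , u , v = lower (proj₁ ((x ⊕ y) ⊕ z)) (proj₁ (x ⊕ (y ⊕ z)))
          pˣʸ : W ⊑ proj₁ (x ⊕ y)
          pˣʸ w = ⊕-⊑ˡ (x ⊕ y) z (u w)
          pˣ : W ⊑ proj₁ x
          pˣ w = ⊕-⊑ˡ x y (pˣʸ w)
          pʸ : W ⊑ proj₁ y
          pʸ w = ⊕-⊑ʳ x y (pˣʸ w)
          pᶻ : W ⊑ proj₁ z
          pᶻ w = ⊕-⊑ʳ (x ⊕ y) z (u w)
          pʸᶻ : W ⊑ proj₁ (y ⊕ z)
          pʸᶻ w = ⊕-⊑ʳ x (y ⊕ z) (v w)
      in W , u , v ,
         Ab.trans W (↾-⊕ (x ⊕ y) z {W} u pˣʸ pᶻ)
         (Ab.trans W (Ab.∙-congʳ W (↾-⊕ x y {W} pˣʸ pˣ pʸ))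
         (Ab.trans W (Ab.assoc W _ _ _)
         (Ab.sym W (Ab.trans W (↾-⊕ x (y ⊕ z) {W} v pˣ pʸᶻ)
                               (Ab.∙-congˡ W (↾-⊕ y z {W} pʸᶻ pʸ pᶻ))))))

    ⊕-comm : ∀ x y → (x ⊕ y) ∼ (y ⊕ x)
    ⊕-comm x y =
      let W , u , v = lower (proj₁ (x ⊕ y)) (proj₁ (y ⊕ x))
          p : W ⊑ proj₁ x
          p w = ⊕-⊑ˡ x y (u w)
          q : W ⊑ proj₁ y
          q w = ⊕-⊑ʳ x y (u w)
      in W , u , v ,
         Ab.trans W (↾-⊕ x y {W} u p q)
         (Ab.trans W (Ab.comm W _ _) (Ab.sym W (↾-⊕ y x {W} v q p)))

    ⊕-identityˡ : ∀ x → (𝟘 ⊕ x) ∼ x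
    ⊕-identityˡ x =
      let W = proj₁ (𝟘 ⊕ x)
          p : W ⊑ proj₁ x
          p = ⊕-⊑ʳ 𝟘 x
      in W , id , p ,
         Ab.trans W (↾-⊕ 𝟘 x {W} id (⊕-⊑ˡ 𝟘 x) p)
         (Ab.trans W (Ab.∙-congʳ W (ε-homo (Φ.res _))) (Ab.identityˡ W _))

    ⊖-inverseˡ : ∀ x → ((⊖ x) ⊕ x) ∼ 𝟘
    ⊖-inverseˡ x =
      let W , u , v = lower (proj₁ ((⊖ x) ⊕ x)) (proj₁ 𝟘)
          p : W ⊑ proj₁ x
          p w = ⊕-⊑ˡ (⊖ x) x (u w)
      in W , u , v ,
         Ab.trans W (↾-⊕ (⊖ x) x {W} u p p)
         (Ab.trans W (Ab.∙-congʳ W (⁻¹-homo (Φ.res _) _))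
         (Ab.trans W (Ab.inverseˡ W _) (Ab.sym W (ε-homo (Φ.res _)))))

    ⊖-cong : ∀ {x y} → x ∼ y → (⊖ x) ∼ (⊖ y)
    ⊖-cong (W , p , q , e) = W , p , q ,
      Ab.trans W (⁻¹-homo (Φ.res _) _)
        (Ab.trans W (Ab.⁻¹-cong W e) (Ab.sym W (⁻¹-homo (Φ.res _) _)))

    germs : AbelianGroup L L
    germs = record
      { Carrier = Germ
      ; _≈_     = _∼_
      ; _∙_     = _⊕_
      ; ε       = 𝟘
      ; _⁻¹     = ⊖_
      ; isAbelianGroup = record
        { isGroup = record
          { isMonoid = record
            { isSemigroup = record
              { isMagma = record
                { isEquivalence = record
                  { refl  = λ {x} → ∼-refl {x}
                  ; sym   = λ {x} {y} → ∼-sym {x} {y}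
                  ; trans = λ {x} {y} {z} → ∼-trans {x} {y} {z} }
                ; ∙-cong = λ {x} {y} {z} {w} → ⊕-cong {x} {y} {z} {w} }
              ; assoc = ⊕-assoc }
            ; identity = ⊕-identityˡ , λ x →
                ∼-trans {x ⊕ 𝟘} {𝟘 ⊕ x} {x} (⊕-comm x 𝟘) (⊕-identityˡ x) }
          ; inverse = ⊖-inverseˡ , λ x →
              ∼-trans {x ⊕ (⊖ x)} {(⊖ x) ⊕ x} {𝟘} (⊕-comm x (⊖ x)) (⊖-inverseˡ x)
          ; ⁻¹-cong = λ {x} {y} → ⊖-cong {x} {y} }
        ; comm = ⊕-comm }
      }

    _⋆_ : G.Carrier → Germ → Germ
    g ⋆ (U , x) = U , ⟦ Φ.con g {base U} {base U} (▷-≐ g U) ⟧ x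

    ↾-⋆ : ∀ g x {W} (p : W ⊑ proj₁ x) →
          _↾_ (g ⋆ x) {W} p Φ.≈ ⟦ Φ.con g {base W} {base W} (▷-≐ g W) ⟧ (_↾_ x {W} p)
    ↾-⋆ g (U , x) {W} p = Ab.sym W (Φ.con-res _ _ (▷-≐ g U) (▷-≐ g W) x)

    ⋆-cong : ∀ {g g′ x y} → g G.≈ g′ → x ∼ y → (g ⋆ x) ∼ (g′ ⋆ y)
    ⋆-cong {g} {g′} {x} {y} g≈g′ (W , p , q , e) = W , p , q ,
      Ab.trans W (↾-⋆ g x {W} p)
      (Ab.trans W (Φ.con-cong (▷-≐ g W) (▷-≐ g′ W) g≈g′ _)
      (Ab.trans W (⟦⟧-cong (Φ.con g′ _) e) (Ab.sym W (↾-⋆ g′ y {W} q))))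

    ⋆-⊕ : ∀ g x y → (g ⋆ (x ⊕ y)) ∼ ((g ⋆ x) ⊕ (g ⋆ y))
    ⋆-⊕ g x y = pointwise {W} (Ab.trans W (homo (Φ.con g _) _ _)
      (Ab.sym W (Ab.∙-cong W (↾-⋆ g x {W} (⊕-⊑ˡ x y)) (↾-⋆ g y {W} (⊕-⊑ʳ x y)))))
      where W = proj₁ (x ⊕ y)

    ⋆-continuous : ∀ g x → ∃[ V ] G.Open V × g ∈ V × (∀ {v} → v ∈ V → (v ⋆ x) ∼ (g ⋆ x))
    ⋆-continuous g x@((U , U∈) , y) =
      let _ , V , _ , V-open , g⁻¹∈ , g∈ , VV⊆U =
            G.∙-continuous (𝒰-open U∈) {g G.⁻¹} {g} (resp U (G.sym (G.inverseˡ g)) (ε∈ U))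
      in V , V-open , g∈ , λ {v} v∈ →
         let u = g G.⁻¹ G.∙ v
             g∙u≈v = G.trans (G.sym (G.assoc g (g G.⁻¹) v))
                       (G.trans (G.∙-congʳ (G.inverseʳ g)) (G.identityˡ v))
         in pointwise {U , U∈}
           (Ab.trans (U , U∈)
             (Φ.con-cong (▷-≐ v (U , U∈)) (▷-≐ (g G.∙ u) (U , U∈)) (G.sym g∙u≈v) y)
           (Ab.trans (U , U∈)
             (Ab.sym (U , U∈) (Φ.con-trans (▷-≐ u (U , U∈)) (▷-≐ g (U , U∈)) _ y))
             (⟦⟧-cong (Φ.con g _) (Φ.con-id (VV⊆U g⁻¹∈ v∈) _ y))))

    colimit : DiscreteModule 𝔾 L
    colimit = record
      { abelianGroup = germs
      ; _·_          = _⋆_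
      ; ·-cong       = λ {_} {_} {x} {y} → ⋆-cong {_} {_} {x} {y}
      ; ·-distrib-+  = ⋆-⊕
      ; ·-assoc      = λ g g′ (U , x) → pointwise {U}
          (Ab.sym U (Φ.con-trans (▷-≐ g′ U) (▷-≐ g U) (▷-≐ (g G.∙ g′) U) x))
      ; ·-identity   = λ (U , x) → pointwise {U} (Φ.con-id (ε∈ (proj₁ U)) _ x)
      ; ·-continuous = ⋆-continuous
      }

  module _ {Φ Ψ : MackeyFunctor 𝔐 L} (α : MackeyMorphism 𝔐 L Φ Ψ) where
    open MackeyMorphism α
    private
      module Φ = MackeyFunctor Φ
      module Ψ = MackeyFunctor Ψ
      module Ab U = AbelianGroup (Ψ.Φ (base U))

    germ-map : Germ Φ → Germ Ψ
    germ-map (U , x) = U , ⟦ φ (base U) ⟧ x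

    pointwise′ : ∀ {U x y} → x Ψ.≈ y → _∼_ Ψ (U , x) (U , y)
    pointwise′ {U} e = U , id , id , ⟦⟧-cong (Ψ.res _) e

    colimit-map : ModuleMorphism 𝔾 L (colimit Φ) (colimit Ψ)
    colimit-map = record
      { hom = mkHom (germs Φ) (germs Ψ) germ-map
          (λ (W , p , q , e) → W , p , q , Ab.trans W (Ab.sym W (φ-res _ _))
            (Ab.trans W (⟦⟧-cong (φ (base W)) e) (φ-res _ _)))
          (λ x y → let W = proj₁ (_⊕_ Φ x y) in pointwise′ {W}
            (Ab.trans W (homo (φ (base W)) _ _) (Ab.∙-cong W (φ-res _ _) (φ-res _ _))))
      ; equivariant = λ g (U , x) → pointwise′ {U} (φ-con g (▷-≐ g U) x)
      }

  colimitFunctor : Functor (Mack 𝔐 L) (DiscreteModules 𝔾 L)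
  colimitFunctor = record
    { F₀   = colimit
    ; F₁   = colimit-map
    ; F-≈  = λ {_} {Ψ} α≈β (U , x) →
        U , id , id , ⟦⟧-cong (MackeyFunctor.res Ψ _) (α≈β (base U) x)
    ; F-id = λ {Φ} x → DiscreteModule.refl (colimit Φ) {x}
    ; F-∘  = λ {_} {_} {Ξ} α β x →
        DiscreteModule.refl (colimit Ξ) {germ-map α (germ-map β x)}
    }

{-# OPTIONS --safe #-}

-- The transpose of k : colim Φ → A sends x ∈ Φ(H) to k[res_{U,H} x], for any
-- U ∈ 𝒰(H); the transpose of α : Φ → A_* sends [x], x ∈ Φ(U), to α_U(x).  The
-- only point of substance is that the former commutes with ind_{H,I}.  If
-- U ∈ 𝒰(I), then U∖H/I = H/I, U ∩ ʰI = U and Uʰ ∩ I = U by normality of U,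
-- whence the Mackey formula becomes
--   res_{U,H} ind_{H,I} = ∑_{h ∈ H/I} con_h res_{U,I}.
module Submission where

open import Algebra.Bundles using (Group; AbelianGroup)
open import Algebra.Morphism.Bundles using (GroupHomomorphism)
open import Data.Fin.Base using (Fin)
open import Data.Product.Base using (_,_; proj₁; proj₂)
open import Defs
open import Function.Base using (id)
open import Function.Bundles using (Inverse)
open import Level using (Level; _⊔_; suc)
import Relation.Binary.Reasoning.Setoid as ≈-Reasoning
open import Relation.Unary using (_∈_; _⊆_; _≐_)

open GroupHomomorphism using (⟦_⟧; ⟦⟧-cong; homo)
open Subgroup

module _ {ℓ} {G : Group ℓ ℓ} where
  open Group G
  open Conjugation G

  ▷-ε : ∀ {H K : Subgroup G} → mem K ≐ mem H → mem K ≐ mem (ε ▷ H)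
  ▷-ε {H} (p , q) = (λ {x} r → resp H (sym (c-id x)) (p r)) ,
                    (λ {x} r → q (resp H (c-id x) r))

  doubleCosetsOfNormal : ∀ {H I N : Subgroup G} → Normal N → mem N ⊆ mem I →
                         H / I → [ N ╲ H / I ]
  doubleCosetsOfNormal {H} {I} {N} normal N≤I R = record
    { size     = size R
    ; rep      = rep R
    ; rep∈     = rep∈ R
    ; covers   = λ x∈ → let k , j , j∈ , p = covers R x∈ in
        k , ε , j , ε∈ N , j∈ , trans p (∙-congʳ (sym (identityˡ _)))
    ; distinct = λ {k} {l} (n , j , n∈ , j∈ , p) → distinct R
        ( c (rep R l) n ∙ j
        , ∙∈ I (N≤I (proj₁ (▷-normal {H = N} normal (rep R l)) n∈)) j∈
        , trans p (trans (∙-congʳ (sym (g∙c (rep R l) n))) (assoc _ _ _)) )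
    }

  ◁∩-normal : ∀ {I J : Subgroup G} → Normal I → mem I ⊆ mem J → ∀ h →
              mem I ≐ mem (I ◁ h ∩ₛ J)
  ◁∩-normal {I} normal I≤J h = let p , q = ▷-normal {H = I} normal (h ⁻¹) in
    (λ x∈ → p x∈ , I≤J x∈) , (λ (x∈ , _) → q x∈)

  ∩▷-normal : ∀ {I J : Subgroup G} → Normal I → mem I ⊆ mem J → ∀ h →
              mem I ≐ mem (I ∩ₛ h ▷ J)
  ∩▷-normal {I} normal I≤J h =
    (λ x∈ → x∈ , I≤J (proj₁ (▷-normal {H = I} normal h) x∈)) , proj₁

module _ {ℓ s m} {G : Group ℓ ℓ} {𝔐 : MackeySystem G s} (Ψ : MackeyFunctor 𝔐 m) where
  private module G = Group G
  open MackeySystem 𝔐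
  open MackeyFunctor Ψ
  private module Ab H = AbelianGroup (Φ H)

  ind-≐ : ∀ {H I} (p : I ∈ 𝔖 𝐢 H) (e : ⌊ H ⌋ ≐ ⌊ G.ε ▷ᵇ I ⌋) x →
          ⟦ ind p ⟧ x ≈ ⟦ con G.ε {I} {H} e ⟧ x
  ind-≐ {H} {I} p e x = begin
    ⟦ ind p ⟧ x                             ≈⟨ con-id (ε∈ (proj₁ H)) H≐ _ ⟨
    ⟦ con _ {H} {H} H≐ ⟧ (⟦ ind p ⟧ x)      ≈⟨ con-ind p (𝔖-refl 𝐢) H≐ e x ⟩
    ⟦ ind (𝔖-refl 𝐢) ⟧ (⟦ con _ e ⟧ x)      ≈⟨ ind-id (𝔖-refl 𝐢) _ ⟩
    ⟦ con _ {I} {H} e ⟧ x                   ∎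
    where
    open ≈-Reasoning (Ab.setoid H)
    H≐ = ▷-ε {H = proj₁ H} {proj₁ H} (id , id)

  res-≐ : ∀ {H I J} (p : I ∈ 𝔖 𝐫 H) (q : J ∈ 𝔖 𝐫 H) (e : ⌊ J ⌋ ≐ ⌊ G.ε ▷ᵇ I ⌋) x →
          ⟦ con G.ε {I} {J} e ⟧ (⟦ res p ⟧ x) ≈ ⟦ res q ⟧ x
  res-≐ {H} {I} {J} p q e x = begin
    ⟦ con _ {I} {J} e ⟧ (⟦ res p ⟧ x)     ≈⟨ con-res p q H≐ e x ⟩
    ⟦ res q ⟧ (⟦ con _ {H} {H} H≐ ⟧ x)    ≈⟨ ⟦⟧-cong (res q) (con-id (ε∈ (proj₁ H)) H≐ x) ⟩
    ⟦ res q ⟧ x                           ∎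
    where
    open ≈-Reasoning (Ab.setoid J)
    H≐ = ▷-ε {H = proj₁ H} {proj₁ H} (id , id)

  res-ind-normal : ∀ {H I U} (p : U ∈ 𝔖 𝐫 H) (q : I ∈ 𝔖 𝐢 H) (r : U ∈ 𝔖 𝐫 I)
                   (normal : Normal (proj₁ U)) (R : proj₁ H / proj₁ I) x →
                   ⟦ res p ⟧ (⟦ ind q ⟧ x) ≈
                   ∑ (Φ U) λ k → ⟦ con (rep R k) {U} {U} (▷-normal {H = proj₁ U} normal (rep R k)) ⟧
                                 (⟦ res r ⟧ x)
  res-ind-normal {H} {I} {U} p q r normal R x = Ab.trans U
    (mackey p q (doubleCosetsOfNormal {H = proj₁ H} {proj₁ I} {proj₁ U} normal U≤I R) x)
    (∑-cong (Φ U) {size R} summand)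
    where
    U≤I : ⌊ U ⌋ ⊆ ⌊ I ⌋
    U≤I = 𝔖-≤ 𝐫 r
    summand : ∀ k →
      ⟦ ind (I∩ʰJ∈𝔖𝐢 p q (rep∈ R k)) ⟧
        (⟦ con (rep R k) {Iʰ∩J p q (rep∈ R k)} {I∩ʰJ p q (rep∈ R k)}
               (I∩ʰJ≐ʰ[Iʰ∩J] p q (rep∈ R k)) ⟧
        (⟦ res (Iʰ∩J∈𝔖𝐫 p q (rep∈ R k)) ⟧ x)) ≈
      ⟦ con (rep R k) {U} {U} (▷-normal {H = proj₁ U} normal (rep R k)) ⟧ (⟦ res r ⟧ x)
    summand k = begin
      ⟦ ind (I∩ʰJ∈𝔖𝐢 p q h∈) ⟧ (⟦ con h {V} {T} T≐ ⟧ y)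
        ≈⟨ ind-≐ (I∩ʰJ∈𝔖𝐢 p q h∈) U≐T _ ⟩
      ⟦ con _ {T} {U} U≐T ⟧ (⟦ con h {V} {T} T≐ ⟧ y)
        ≈⟨ con-trans T≐ U≐T εh y ⟩
      ⟦ con _ {V} {U} εh ⟧ y
        ≈⟨ con-cong εh hε (G.trans (G.identityˡ h) (G.sym (G.identityʳ h))) y ⟩
      ⟦ con _ {V} {U} hε ⟧ y
        ≈⟨ con-trans U≐V U≐ hε y ⟨
      ⟦ con h {U} {U} U≐ ⟧ (⟦ con _ {V} {U} U≐V ⟧ y)
        ≈⟨ ⟦⟧-cong (con h {U} {U} U≐) (res-≐ (Iʰ∩J∈𝔖𝐫 p q h∈) r U≐V x) ⟩
      ⟦ con h {U} {U} U≐ ⟧ (⟦ res r ⟧ x) ∎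
      where
      open ≈-Reasoning (Ab.setoid U)
      open Conjugation G using (c-cong)
      h = rep R k
      h∈ = rep∈ R k
      V = Iʰ∩J p q h∈
      T = I∩ʰJ p q h∈
      y = ⟦ res (Iʰ∩J∈𝔖𝐫 p q h∈) ⟧ x
      T≐ = I∩ʰJ≐ʰ[Iʰ∩J] p q h∈
      U≐ = ▷-normal {H = proj₁ U} normal h
      U≐T : ⌊ U ⌋ ≐ ⌊ G.ε ▷ᵇ T ⌋
      U≐T = ▷-ε {H = proj₁ T} {proj₁ U} (∩▷-normal {I = proj₁ U} {proj₁ I} normal U≤I h)
      U≐V : ⌊ U ⌋ ≐ ⌊ G.ε ▷ᵇ V ⌋
      U≐V = ▷-ε {H = proj₁ V} {proj₁ U} (◁∩-normal {I = proj₁ U} {proj₁ I} normal U≤I h)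
      U≐ʰV : ⌊ U ⌋ ≐ ⌊ h ▷ᵇ V ⌋
      U≐ʰV = let a , b = ∩▷-normal {I = proj₁ U} {proj₁ I} normal U≤I h in
        (λ x∈ → proj₁ T≐ (a x∈)) , (λ x∈ → b (proj₂ T≐ x∈))
      ≐-along : ∀ {g} → h G.≈ g → ⌊ U ⌋ ≐ ⌊ g ▷ᵇ V ⌋
      ≐-along e =
        (λ x∈ → resp (proj₁ V) (c-cong e G.refl) (proj₁ U≐ʰV x∈)) ,
        (λ x∈ → proj₂ U≐ʰV (resp (proj₁ V) (c-cong (G.sym e) G.refl) x∈))
      εh = ≐-along (G.sym (G.identityˡ h))
      hε = ≐-along (G.sym (G.identityʳ h))

module _ {ℓ t s : Level} (a : Level) (𝔾 : TopologicalGroup ℓ t)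
         (𝔐 : MackeySystem (TopologicalGroup.group 𝔾) s)
         (finite : MackeySystem.IFinite 𝔐)
         (𝔘 : DescentBasis 𝔾 𝔐) where
  private L = suc ℓ ⊔ s ⊔ a
  open MackeySystem 𝔐
  open DescentBasis 𝔘

  -- Named because each application to finite η-expands it anew, and functors that
  -- differ by this expansion are very costly to compare (likewise for the theorem,
  -- which is therefore stated without arguments on the left).
  fixedPoints′ : Functor (DiscreteModules 𝔾 L) (Mack 𝔐 L)
  fixedPoints′ = fixedPointsFunctor {𝔾 = 𝔾} {𝔐 = 𝔐} finite (suc ℓ ⊔ s ⊔ a)

  below : Base → Index a 𝔘
  below H = let U , U∈ , _ = 𝒰-below H in U , U∈

  below-≤ : ∀ H → mem (proj₁ (below H)) ⊆ ⌊ H ⌋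
  below-≤ H = proj₂ (proj₂ (𝒰-below H))

  module _ (Φ : MackeyFunctor 𝔐 L) where
    private
      module Φ = MackeyFunctor Φ
      module Ab U = AbelianGroup (Φ.Φ (base a 𝔘 U))
      module Colim = DiscreteModule (colimit a 𝔘 Φ)

    germAt : ∀ U → Hom (Φ.Φ (base a 𝔘 U)) (germs a 𝔘 Φ)
    germAt U = mkHom (Φ.Φ (base a 𝔘 U)) (germs a 𝔘 Φ) (U ,_) (pointwise a 𝔘 Φ {U})
      (λ x y → let W , p , q = lower a 𝔘 U U in
        W , p , id , Ab.trans W (homo (Φ.res _) x y)
          (Ab.sym W (Ab.trans W (Φ.res-id _ _)
            (Ab.∙-cong W (res-irrelevant a 𝔘 Φ _ _ x) (res-irrelevant a 𝔘 Φ _ _ y)))))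

    germ-res : ∀ {H} {V W : Index a 𝔘} x →
               (p : mem (proj₁ V) ⊆ ⌊ H ⌋) (q : mem (proj₁ W) ⊆ ⌊ H ⌋) →
               (V , ⟦ Φ.res (𝒰-res H (proj₂ V) p) ⟧ x)
                 Colim.≈ (W , ⟦ Φ.res (𝒰-res H (proj₂ W) q) ⟧ x)
    germ-res {H} {V} {W} x p q = let U , v , w = lower a 𝔘 V W in
      U , v , w , Ab.trans U (Φ.res-trans _ _ (𝒰-res H (proj₂ U) (λ u∈ → p (v u∈))) x)
                             (Ab.sym U (Φ.res-trans _ _ _ x))

    germ : ∀ H → ∣ Φ.Φ H ∣ → Germ a 𝔘 Φ
    germ H x = below H , ⟦ Φ.res (𝒰-res H (proj₂ (below H)) (below-≤ H)) ⟧ x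

    germ-hom : ∀ H → Hom (Φ.Φ H) (germs a 𝔘 Φ)
    germ-hom H = _∘ʰ_ {A = Φ.Φ H} {Φ.Φ (base a 𝔘 (below H))} {germs a 𝔘 Φ}
      (germAt (below H)) (Φ.res (𝒰-res H (proj₂ (below H)) (below-≤ H)))

    germ-con : ∀ g {H K} (p : ⌊ K ⌋ ≐ ⌊ g ▷ᵇ H ⌋) x →
               germ K (⟦ Φ.con g {H} {K} p ⟧ x) Colim.≈ g Colim.· germ H x
    germ-con g {H} {K} p x = Colim.trans
      {germ K (⟦ Φ.con g {H} {K} p ⟧ x)}
      {U , ⟦ Φ.res (𝒰-res K (proj₂ U) U≤K) ⟧ (⟦ Φ.con g {H} {K} p ⟧ x)}
      {g Colim.· germ H x}
      (germ-res {K} {below K} {U} _ (below-≤ K) U≤K)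
      (pointwise a 𝔘 Φ {U} (Ab.sym U (Φ.con-res _ _ p (▷-≐ a 𝔘 g U) x)))
      where
      U = below H
      U≤K : mem (proj₁ U) ⊆ ⌊ K ⌋
      U≤K u∈ = proj₂ p (below-≤ H (proj₁ (▷-≐ a 𝔘 g U) u∈))

    germ-ind : ∀ {H I} (p : I ∈ 𝔖 𝐢 H) (R : proj₁ H / proj₁ I) x →
               germ H (⟦ Φ.ind p ⟧ x)
                 Colim.≈ ∑ (germs a 𝔘 Φ) (λ k → rep R k Colim.· germ I x)
    germ-ind {H} {I} p R x = Colim.trans
      {germ H (⟦ Φ.ind p ⟧ x)}
      {U , ⟦ Φ.res U∈H ⟧ (⟦ Φ.ind p ⟧ x)}
      {∑ (germs a 𝔘 Φ) (λ k → rep R k Colim.· germ I x)}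
      (germ-res {H} {below H} {U} (⟦ Φ.ind p ⟧ x) (below-≤ H) U≤H)
      (Colim.trans
        {U , ⟦ Φ.res U∈H ⟧ (⟦ Φ.ind p ⟧ x)}
        {U , ∑ (Φ.Φ (base a 𝔘 U)) conjugates}
        {∑ (germs a 𝔘 Φ) (λ k → rep R k Colim.· germ I x)}
        (pointwise a 𝔘 Φ {U} (res-ind-normal Φ {H} {I} {base a 𝔘 U} U∈H p
          (𝒰-res I (proj₂ U) (below-≤ I)) (𝒰-normal (proj₂ U)) R x))
        (hom-∑ (Φ.Φ (base a 𝔘 U)) (germs a 𝔘 Φ) (germAt U) conjugates))
      where
      U = below I
      U≤H : mem (proj₁ U) ⊆ ⌊ H ⌋
      U≤H u∈ = 𝔖-≤ 𝐢 p (below-≤ I u∈)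
      U∈H : base a 𝔘 U ∈ 𝔖 𝐫 H
      U∈H = 𝒰-res H (proj₂ U) U≤H
      conjugates : Fin (size R) → ∣ Φ.Φ (base a 𝔘 U) ∣
      conjugates k = ⟦ Φ.con (rep R k) {base a 𝔘 U} {base a 𝔘 U} (▷-≐ a 𝔘 (rep R k) U) ⟧
                       (proj₂ (germ I x))

    module _ (A : DiscreteModule 𝔾 L) where
      private
        module A = DiscreteModule A
        A_* = Functor.F₀ fixedPoints′ A
      open ModuleMorphism
      open MackeyMorphism

      germ-fixed : ∀ (k : ModuleMorphism 𝔾 L (colimit a 𝔘 Φ) A) H x →
                   ⟦ hom k ⟧ (germ H x) ∈ Fixed L A (proj₁ H)
      germ-fixed k H x {h} h∈ = A.trans (A.sym (equivariant k h _))
        (⟦⟧-cong (hom k) (Colim.sym {germ H x} {h Colim.· germ H x}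
          (Colim.trans {germ H x} {germ H (⟦ Φ.con h {H} {H} h▷H ⟧ x)} {h Colim.· germ H x}
            (⟦⟧-cong (germ-hom H) (AbelianGroup.sym (Φ.Φ H) (Φ.con-id h∈ h▷H x)))
            (germ-con h {H} {H} h▷H x))))
        where h▷H = ▷-self (proj₁ H) h∈

      rightTranspose : ModuleMorphism 𝔾 L (colimit a 𝔘 Φ) A → MackeyMorphism 𝔐 L Φ A_*
      rightTranspose k = record
        { φ     = λ H → mkHom (Φ.Φ H) (_^_ L A (proj₁ H))
            (λ x → ⟦ hom k ⟧ (germ H x) , germ-fixed k H x)
            (λ x≈y → ⟦⟧-cong (hom k) (⟦⟧-cong (germ-hom H) x≈y))
            (λ x y → A.trans (⟦⟧-cong (hom k) (homo (germ-hom H) x y)) (homo (hom k) _ _))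
        ; φ-res = λ {H} {I} p x → ⟦⟧-cong (hom k) (Colim.trans
            {germ I (⟦ Φ.res p ⟧ x)}
            {below I , ⟦ Φ.res (𝒰-res H (proj₂ (below I)) (λ u∈ → 𝔖-≤ 𝐫 p (below-≤ I u∈))) ⟧ x}
            {germ H x}
            (pointwise a 𝔘 Φ {below I} (Φ.res-trans p _ _ x))
            (germ-res {H} {below I} {below H} x _ (below-≤ H)))
        ; φ-ind = λ {H} {I} p x → A.trans
            (⟦⟧-cong (hom k) (germ-ind p (finite p) x))
            (A.trans (hom-∑ (germs a 𝔘 Φ) A.abelianGroup (hom k) {size (finite p)} _)
              (∑-cong A.abelianGroup {size (finite p)} (λ l → equivariant k _ (germ I x))))
        ; φ-con = λ g {H} {K} p x → A.trans (⟦⟧-cong (hom k) (germ-con g {H} {K} p x))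
            (equivariant k g (germ H x))
        }

      leftTranspose : MackeyMorphism 𝔐 L Φ A_* → ModuleMorphism 𝔾 L (colimit a 𝔘 Φ) A
      leftTranspose α = record
        { hom = mkHom (germs a 𝔘 Φ) A.abelianGroup value
            (λ { {U , x} {V , y} (W , p , q , e) → A.trans (A.sym (φ-res α _ x))
              (A.trans (⟦⟧-cong (φ α (base a 𝔘 W)) e) (φ-res α _ y)) })
            (λ x y → A.trans (homo (φ α (base a 𝔘 (proj₁ (_⊕_ a 𝔘 Φ x y)))) _ _)
              (A.+-cong (φ-res α _ (proj₂ x)) (φ-res α _ (proj₂ y))))
        ; equivariant = λ g (U , x) → φ-con α g (▷-≐ a 𝔘 g U) x
        }
        where
        value : Germ a 𝔘 Φ → A.Carrier
        value (U , x) = proj₁ (⟦ φ α (base a 𝔘 U) ⟧ x)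

      transpose : Inverse (Category.homSetoid (DiscreteModules 𝔾 L) (colimit a 𝔘 Φ) A)
                          (Category.homSetoid (Mack 𝔐 L) Φ A_*)
      transpose = record
        { to        = rightTranspose
        ; from      = leftTranspose
        ; to-cong   = λ k≈k′ H x → k≈k′ (germ H x)
        ; from-cong = λ α≈β (U , x) → α≈β (base a 𝔘 U) x
        ; inverse   =
            (λ {α} k≈ H x → A.trans (k≈ (germ H x)) (φ-res α _ x)) ,
            (λ { {k} α≈ (U , x) → A.trans (α≈ (base a 𝔘 U) x) (⟦⟧-cong (hom k)
              (below (base a 𝔘 U) , id , below-≤ (base a 𝔘 U) , Φ.res-id _ _)) })
        }

  adjunction : colimitFunctor a 𝔘 ⊣ fixedPoints′
  adjunction = record
    { hom↔    = transpose
    ; natural = λ {Φ} f g k H x → ⟦⟧-cong (hom g) (⟦⟧-cong (hom k)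
        (pointwise a 𝔘 Φ {below H} (φ-res f _ x)))
    }
    where
    open ModuleMorphism
    open MackeyMorphism

theorem2p3p17 : ∀ {ℓ t s : Level} (a : Level) (G : TopologicalGroup ℓ t)
    (𝔐 : MackeySystem (TopologicalGroup.group G) s)
    (finite : MackeySystem.IFinite 𝔐)
    (𝒰 : DescentBasis G 𝔐) →
    colimitFunctor a 𝒰 ⊣ fixedPointsFunctor {𝔾 = G} finite (suc ℓ ⊔ s ⊔ a)
theorem2p3p17 = adjunction
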